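{- Let $X$ be a countable set and let $E$ be a non-empty, at most countable set. Let $$\mathcal{R}_0=\{R\in\mathcal{P}(X\times E\times X)\mid \mathcal{M}(\mathcal{T}_R)\in\boldsymbol{\Sigma}^0_2(\mathcal{P}(X))\},$$ $$\mathcal{R}_1=\{R\in\mathcal{P}(X\times E\times X)\mid \mathcal{M}(\mathcal{T}_R)\text{ is }\boldsymbol{\Pi}^0_3\text{ -complete}\}=\mathcal{P}(X\times E\times X)\setminus\mathcal{R}_0 .$$ Then: (1) both $\mathcal{R}_0$ and $\mathcal{R}_1$ are Borel subsets of $\mathcal{P}(X\times E\times X)$; (2) the set $\mathcal{R}_0$ is comeagre in $\mathcal{P}(X\times E\times X)$; equivalently, the set $\mathcal{R}_1$ is meagre in $\mathcal{P}(X\times E\times X)$.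
   Context: "Countable" means countably infinite (the paper writes "at most countable" when finite sets are allowed). $E^{<\omega}$ is the set of finite sequences over $E$; for $s\in E^{<\omega}$, $\mathrm{length}(s)$ is its length and $s(h)$, $0\le h<\mathrm{length}(s)$, its entries. For $R\subseteq X\times E\times X$ and a finite $F\subseteq E^{<\omega}$ put $$U_F^R=\{q_0\in X\mid \forall s\in F\ \exists q_1,\ldots,q_{\mathrm{length}(s)}\in X\ \forall h\in\{0,\ldots,\mathrm{length}(s)-1\}\ (q_h,s(h),q_{h+1})\in R\}.$$ $\mathcal{T}_R$ is the topology on $X$ generated by the sets $U_F^R$, for $F$ ranging over the finite subsets of $E^{<\omega}$; since $U_F^R\cap U_G^R=U_{F\cup G}^R$, these sets (the non-empty ones) form a basis, and $\mathcal{T}_R$ is second countable. For a topology $\mathcal{T}$ on $X$, a subset $A\subseteq X$ is dense in an open set $U$ if $U\subseteq\overline{A}$, and codense in $U$ if $U\subseteq\overline{X\setminus A}$; $A$ is monitorable if for every non-empty open set $U$ either $A$ is not dense in $U$ or $A$ is not codense in $U$. $\mathcal{M}(\mathcal{T})\subseteq\mathcal{P}(X)$ is the family of subsets of $X$ that are monitorable with respect to $\mathcal{T}$. Powersets $\mathcal{P}(X)$ and $\mathcal{P}(X\times E\times X)$ are identified with $2^X$ and $2^{X\times E\times X}$ via characteristic functions and carry the product topology (with $2=\{0,1\}$ discrete). $\boldsymbol{\Sigma}^0_\alpha,\boldsymbol{\Pi}^0_\alpha$ are the usual classes of the Borel hierarchy ($\boldsymbol{\Sigma}^0_1$ = open sets,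 $\boldsymbol{\Pi}^0_\alpha$ = complements of $\boldsymbol{\Sigma}^0_\alpha$ sets, $\boldsymbol{\Sigma}^0_\alpha$ = at most countable unions of sets in $\bigcup_{\beta<\alpha}\boldsymbol{\Pi}^0_\beta$ for $\alpha\geq 2$). For a boldface pointclass $\boldsymbol{\Gamma}$ and a Polish space $Z$, a set $A\subseteq Z$ is $\boldsymbol{\Gamma}$-complete if $A\in\boldsymbol{\Gamma}(Z)$ and for every zero-dimensional Polish space $Y$ and every $B\in\boldsymbol{\Gamma}(Y)$ there is a continuous $f:Y\to Z$ with $B=f^{ -1}(A)$. The equality $\mathcal{R}_1=\mathcal{P}(X\times E\times X)\setminus\mathcal{R}_0$ holds because, for a countable second countable space, the family of monitorable sets is either $\boldsymbol{\Sigma}^0_2$ or $\boldsymbol{\Pi}^0_3$-complete. A set is meagre if it is an at most countable union of nowhere dense sets, and comeagre if its complement is meagre. -}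

module Defs where

open import Level using (Level; 0ℓ; _⊔_) renaming (suc to lsuc)
open import Data.Bool.Base using (Bool; T)
open import Data.Fin.Base using (Fin; zero; suc; inject₁)
open import Data.List.Base using (List; []; _∷_; _++_; length; lookup)
open import Data.List.Relation.Unary.All using (All; []; _∷_)
open import Data.List.Relation.Unary.All.Properties using (++⁺; ++⁻ˡ; ++⁻ʳ)
open import Data.Nat.Base as ℕ using (ℕ)
open import Data.Product.Base using (_×_; _,_; Σ-syntax; ∃; ∃₂)
open import Data.Rational.Base as ℚ using (ℚ; 0ℚ; 1ℚ)
import Data.Rational.Properties as ℚ
open import Data.Sum.Base using (_⊎_)
open import Data.Unit.Base using (tt)
open import Function.Base using (_∘_)
open import Function.Bundles using (_⇔_; _↣_)
open import Function.Metric.Structures using (IsGeneralMetric)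
open import Relation.Binary.Core using (Rel)
open import Relation.Binary.PropositionalEquality.Core using (_≡_; sym)
open import Relation.Nullary.Negation.Core using (¬_)
open import Relation.Unary
  using (Pred; _∈_; _⊆_; _≐_; _∩_; ∁; ⋃; U; _≬_; _⊢_; Satisfiable; Empty; Universal)

private
  variable
    ℓ : Level
    Z : Set

-- Finite types are included.
AtMostCountable : Set → Set
AtMostCountable I = I ↣ ℕ

------------------------------------------------------------------------
-- Topological spaces

-- Unions are indexed by small types; classically every union of small
-- open sets is of this form.
record Topology (Z : Set) : Set₁ where
  field
    Open      : Pred (Pred Z 0ℓ) 0ℓ
    open-resp : ∀ {A B} → A ≐ B → Open A → Open B
    open-U    : Open U
    open-∩    : ∀ {A B} → Open A → Open B → Open (A ∩ B)
    open-⋃    : ∀ {I : Set} {A : I → Pred Z 0ℓ} →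
                (∀ i → Open (A i)) → Open (⋃ I A)

open Topology public using (Open)

-- The coarsest topology in which all sets S i are open: the open sets are
-- the unions of finite intersections of sets S i.
generated : {I : Set} → (I → Pred Z 0ℓ) → Topology Z
generated {Z} {I} S = record
  { Open      = Opn
  ; open-resp = λ (A⊆B , B⊆A) o z∈B →
      let is , z∈ , ⊆A = o (B⊆A z∈B) in is , z∈ , (λ h → A⊆B (⊆A h))
  ; open-U    = λ _ → [] , [] , (λ _ → tt)
  ; open-∩    = λ o p (z∈A , z∈B) →
      let is , z∈ , ⊆A = o z∈A
          js , z∈′ , ⊆B = p z∈B
      in is ++ js , ++⁺ z∈ z∈′ , (λ h → ⊆A (++⁻ˡ is h) , ⊆B (++⁻ʳ is h))
  ; open-⋃    = λ o (i , z∈A) →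
      let is , z∈ , ⊆A = o i z∈A in is , z∈ , (λ h → i , ⊆A h)
  }
  where
  Opn : Pred (Pred Z 0ℓ) 0ℓ
  Opn A = ∀ {z} → z ∈ A →
    ∃ λ (is : List I) → All (λ i → z ∈ S i) is × (λ y → All (λ i → y ∈ S i) is) ⊆ A

module _ (𝒯 : Topology Z) where

  closure : Pred Z ℓ → Pred Z (lsuc 0ℓ ⊔ ℓ)
  closure A z = ∀ V → Open 𝒯 V → z ∈ V → V ≬ A

  interior : Pred Z ℓ → Pred Z (lsuc 0ℓ ⊔ ℓ)
  interior A z = ∃ λ V → Open 𝒯 V × z ∈ V × V ⊆ A

  DenseIn : Pred Z 0ℓ → Pred Z 0ℓ → Set₁
  DenseIn A V = V ⊆ closure A

  CodenseIn : Pred Z 0ℓ → Pred Z 0ℓ → Set₁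
  CodenseIn A V = V ⊆ closure (∁ A)

  Monitorable : Pred (Pred Z 0ℓ) (lsuc 0ℓ)
  Monitorable A = ∀ V → Open 𝒯 V → Satisfiable V → ¬ DenseIn A V ⊎ ¬ CodenseIn A V

  NowhereDense : Pred Z ℓ → Set (lsuc 0ℓ ⊔ ℓ)
  NowhereDense A = Empty (interior (closure A))

  Meagre : Pred Z ℓ → Set (lsuc 0ℓ ⊔ ℓ)
  Meagre A = Σ[ I ∈ Set ] ∃ λ (N : I → Pred Z 0ℓ) →
    AtMostCountable I × (∀ i → NowhereDense (N i)) × A ≐ ⋃ I N

  Comeagre : Pred Z ℓ → Set (lsuc 0ℓ ⊔ ℓ)
  Comeagre A = Meagre (∁ A)

Continuous : {Y Z : Set} → Topology Y → Topology Z → (Y → Z) → Set₁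
Continuous 𝒮 𝒯 f = ∀ V → Open 𝒯 V → Open 𝒮 (f ⊢ V)

------------------------------------------------------------------------
-- Pointclasses

Pointclass : Set₂
Pointclass = ∀ {Z} → Topology Z → Pred (Pred Z 0ℓ) (lsuc 0ℓ)

data Σ⁰ (𝒯 : Topology Z) : ℕ → Pred Z 0ℓ → Set₁ where
  open-set : ∀ {A} → Open 𝒯 A → Σ⁰ 𝒯 1 A
  union    : ∀ {α A} {I : Set} {B : I → Pred Z 0ℓ} → 2 ℕ.≤ α →
             AtMostCountable I →
             (∀ i → ∃ λ β → 1 ℕ.≤ β × β ℕ.< α × Σ⁰ 𝒯 β (∁ (B i))) →
             A ≐ ⋃ I B → Σ⁰ 𝒯 α A

Π⁰ : Topology Z → ℕ → Pred Z 0ℓ → Set₁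
Π⁰ 𝒯 α A = Σ⁰ 𝒯 α (∁ A)

data Borel (𝒯 : Topology Z) : Pred Z 0ℓ → Set₁ where
  open-set   : ∀ {A} → Open 𝒯 A → Borel 𝒯 A
  complement : ∀ {A} → Borel 𝒯 A → Borel 𝒯 (∁ A)
  union      : {I : Set} {B : I → Pred Z 0ℓ} →
               AtMostCountable I → (∀ i → Borel 𝒯 (B i)) → Borel 𝒯 (⋃ I B)
  resp       : ∀ {A B} → A ≐ B → Borel 𝒯 A → Borel 𝒯 B

-- A set defined by a predicate in a higher universe belongs to Γ when it
-- has the same elements as a small set in Γ.
infix 4 _∈[_]_
_∈[_]_ : Pred Z ℓ → Pointclass → Topology Z → Set (lsuc 0ℓ ⊔ ℓ)
A ∈[ Γ ] 𝒯 = ∃ λ B → A ≐ B × Γ 𝒯 B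

------------------------------------------------------------------------
-- Real numbers

-- Dedekind reals, given by the set of rationals strictly above them.
record ℝ : Set₁ where
  field
    Above     : Pred ℚ 0ℓ
    inhabited : ∃ λ q → q ∈ Above
    bounded   : ∃ λ l → ∀ {q} → q ∈ Above → l ℚ.≤ q
    upward    : ∀ {p q} → p ℚ.< q → p ∈ Above → q ∈ Above
    rounded   : ∀ {q} → q ∈ Above → ∃ λ p → p ℚ.< q × p ∈ Above

open ℝ public

infix 4 _≃_ _≤_ _<ʳ_
infixl 6 _+_

_<ʳ_ : ℝ → ℚ → Set
x <ʳ q = q ∈ Above x

_≃_ : Rel ℝ 0ℓ
x ≃ y = Above x ≐ Above y

_≤_ : Rel ℝ 0ℓ
x ≤ y = Above y ⊆ Above x

0ℝ : ℝ
0ℝ = record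
  { Above     = 0ℚ ℚ.<_
  ; inhabited = 1ℚ , ℚ.positive⁻¹ 1ℚ
  ; bounded   = 0ℚ , ℚ.<⇒≤
  ; upward    = λ p<q 0<p → ℚ.<-trans 0<p p<q
  ; rounded   = λ 0<q → let p , 0<p , p<q = ℚ.<-dense 0<q in p , p<q , 0<p
  }

_+_ : ℝ → ℝ → ℝ
x + y = record
  { Above     = λ q → ∃₂ λ r s → x <ʳ r × y <ʳ s × r ℚ.+ s ℚ.< q
  ; inhabited =
      let r , x<r = inhabited x
          s , y<s = inhabited y
      in r ℚ.+ s ℚ.+ 1ℚ , r , s , x<r , y<s , r+s<r+s+1 (r ℚ.+ s)
  ; bounded   =
      let k , k≤ = bounded x
          l , l≤ = bounded y
      in k ℚ.+ l , λ (r , s , x<r , y<s , r+s<q) →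
           ℚ.≤-trans (ℚ.+-mono-≤ (k≤ x<r) (l≤ y<s)) (ℚ.<⇒≤ r+s<q)
  ; upward    = λ p<q (r , s , x<r , y<s , r+s<p) →
      r , s , x<r , y<s , ℚ.<-trans r+s<p p<q
  ; rounded   = λ (r , s , x<r , y<s , r+s<q) →
      let p , r+s<p , p<q = ℚ.<-dense r+s<q
      in p , p<q , r , s , x<r , y<s , r+s<p
  }
  where
  r+s<r+s+1 : ∀ t → t ℚ.< t ℚ.+ 1ℚ
  r+s<r+s+1 t = ℚ.≤-<-trans (ℚ.≤-reflexive (sym (ℚ.+-identityʳ t)))
                            (ℚ.+-monoʳ-< t (ℚ.positive⁻¹ 1ℚ))

------------------------------------------------------------------------
-- Polish spaces

IsMetric : Rel Z 0ℓ → (Z → Z → ℝ) → Set₁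
IsMetric _≈_ d = IsGeneralMetric _≈_ _≃_ _≤_ 0ℝ _+_ d

module _ (d : Z → Z → ℝ) where

  Cauchy : Pred (ℕ → Z) 0ℓ
  Cauchy s = ∀ ε → 0ℚ ℚ.< ε →
    ∃ λ N → ∀ m n → N ℕ.≤ m → N ℕ.≤ n → d (s m) (s n) <ʳ ε

  ConvergesTo : (ℕ → Z) → Pred Z 0ℓ
  ConvergesTo s z = ∀ ε → 0ℚ ℚ.< ε → ∃ λ N → ∀ n → N ℕ.≤ n → d (s n) z <ʳ ε

  Complete : Set
  Complete = ∀ s → Cauchy s → ∃ λ z → ConvergesTo s z

  Induces : Topology Z → Set₁
  Induces 𝒯 = ∀ V → Open 𝒯 V ⇔
    (∀ {z} → z ∈ V → ∃ λ ε → 0ℚ ℚ.< ε × (λ y → d z y <ʳ ε) ⊆ V)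

Separable : Topology Z → Set₁
Separable {Z} 𝒯 = Σ[ I ∈ Set ] ∃ λ (s : I → Z) →
  AtMostCountable I × Universal (closure 𝒯 (λ z → ∃ λ i → s i ≡ z))

-- The equality _≈_ of the points is not required to be _≡_, so that e.g.
-- spaces of functions, equal when pointwise equal, are included.
CompletelyMetrizable : Topology Z → Set₁
CompletelyMetrizable {Z} 𝒯 = ∃₂ λ (_≈_ : Rel Z 0ℓ) (d : Z → Z → ℝ) →
  IsMetric _≈_ d × Complete d × Induces d 𝒯

Polish : Topology Z → Set₁
Polish 𝒯 = Separable 𝒯 × CompletelyMetrizable 𝒯

-- Existence of a clopen basis; the Hausdorff property is left to Polish.
ZeroDimensional : Topology Z → Set₁
ZeroDimensional 𝒯 = ∀ V → Open 𝒯 V → ∀ {z} → z ∈ V →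
  ∃ λ W → Open 𝒯 W × Open 𝒯 (∁ W) × z ∈ W × W ⊆ V

IsCompleteFor : Pointclass → Topology Z → Pred Z ℓ → Set (lsuc 0ℓ ⊔ ℓ)
IsCompleteFor {Z} Γ 𝒯 A = A ∈[ Γ ] 𝒯 ×
  (∀ {Y : Set} (𝒮 : Topology Y) → Polish 𝒮 → ZeroDimensional 𝒮 →
   ∀ B → Γ 𝒮 B → ∃ λ (f : Y → Z) → Continuous 𝒮 𝒯 f × B ≐ f ⊢ A)

------------------------------------------------------------------------
-- Powersets and the topologies 𝒯_R

𝒫 : Set → Set
𝒫 Z = Z → Bool

⟦_⟧ : 𝒫 Z → Pred Z 0ℓ
⟦ A ⟧ = T ∘ A

product : (Z : Set) → Topology (𝒫 Z)
product Z = generated {I = Z × Bool} (λ (z , b) A → A z ≡ b)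

module _ {X E : Set} where

  -- The finite set F of finite sequences is given by a list.
  basic : 𝒫 (X × E × X) → List (List E) → Pred X 0ℓ
  basic R F q₀ = All
    (λ s → ∃ λ (q : Fin (ℕ.suc (length s)) → X) → q zero ≡ q₀ ×
      (∀ h → (q (inject₁ h) , lookup s h , q (suc h)) ∈ ⟦ R ⟧))
    F

  𝒯⟨_⟩ : 𝒫 (X × E × X) → Topology X
  𝒯⟨ R ⟩ = generated (basic R)

ℳ : {X : Set} → Topology X → Pred (𝒫 X) (lsuc 0ℓ)
ℳ 𝒯 A = Monitorable 𝒯 ⟦ A ⟧

module _ (X E : Set) where

  ℛ₀ : Pred (𝒫 (X × E × X)) (lsuc 0ℓ)
  ℛ₀ R = ℳ 𝒯⟨ R ⟩ ∈[ (λ 𝒮 → Σ⁰ 𝒮 2) ] product X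

  ℛ₁ : Pred (𝒫 (X × E × X)) (lsuc 0ℓ)
  ℛ₁ R = IsCompleteFor (λ 𝒮 → Π⁰ 𝒮 3) (product X) (ℳ 𝒯⟨ R ⟩)

{-# OPTIONS --safe #-}

-- Call a non-empty basic open set minimal if it has no proper non-empty open
-- subset, perfect if it contains no minimal set, and irreducible if any two of
-- its non-empty open subsets meet.  The dividing line is whether finitely many
-- irreducible sets meet every perfect set.
--
-- If they do, A is monitorable iff A is constant on every minimal set and on
-- the members of some finite family of basic sets that meets all perfect sets:
-- a countable union of closed conditions.
--
-- If not, there is an infinite sequence of pairwise disjoint perfect sets s n.
-- Points that are nowhere dense as singletons are dense in each s n.  Given
-- B = ⋂ₙ Sₙ with Sₙ in Σ⁰₂, put finitely many such points of s n into f y when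
-- y ∈ Sₙ, and a set dense and codense in s n otherwise; this reduces B to
-- monitorability.  By the Baire category theorem in Cantor space a Π⁰₃-complete
-- set is not Σ⁰₂, so the two cases exclude each other.
--
-- The dividing line only quantifies over countable sets, hence is Borel.  For
-- comeagrely many R every (x , e) has a successor; then the topology of R is
-- indiscrete and there are no perfect sets.

module Submission where

open import Defs
open import Axiom.ExcludedMiddle using (ExcludedMiddle)
open import Data.Bool.Base using (Bool; true; false; T; _∧_; not; if_then_else_)
import Data.Bool.Properties as Bool
open import Data.Fin.Base using (Fin; zero; suc; inject₁)
open import Data.Integer.Base as ℤ using (ℤ; +_; -[1+_])
import Data.Integer.Properties as ℤ
open import Data.List.Base using (List; []; _∷_; _++_; length; lookup; concat; map)
open import Data.List.Membership.Propositional using () renaming (_∈_ to _∈ₗ_; _∉_ to _∉ₗ_)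
open import Data.List.Membership.Propositional.Properties using (∈-map⁺; ∈-map⁻)
open import Data.List.Relation.Unary.All as All using (All; []; _∷_)
open import Data.List.Relation.Unary.All.Properties using (++⁺; ++⁻ˡ; ++⁻ʳ; concat⁺; concat⁻)
open import Data.List.Relation.Unary.Any using (here; there)
open import Data.Nat.Base as ℕ using (ℕ; zero; suc; z≤n; s≤s)
import Data.Nat.Properties as ℕ
open import Data.Nat.Coprimality using (1-coprimeTo)
open import Data.Product.Base using (_×_; _,_; Σ-syntax; ∃; proj₁; proj₂)
open import Data.Rational.Base as ℚ using (ℚ; 0ℚ; 1ℚ; ½; mkℚ)
import Data.Rational.Properties as ℚ
open import Data.Sum.Base using (_⊎_; inj₁; inj₂)
open import Data.Unit.Base using (⊤; tt)
open import Function.Base using (_∘_; id; case_of_)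
open import Function.Metric.Structures using (IsGeneralMetric)
open import Function.Bundles using (_↔_; _↣_; _⇔_; mk↣; mk⇔; Injection; Inverse; Equivalence)
open import Level using (Level; 0ℓ)
open import Relation.Binary.Definitions using (tri<; tri≈; tri>)
open import Relation.Binary.PropositionalEquality
  using (_≡_; _≢_; refl; sym; trans; cong; cong₂; subst)
open import Relation.Nullary.Decidable using (Dec; yes; no; does; decidable-stable)
open import Relation.Nullary.Negation using (¬_; contradiction)
open import Relation.Unary using (Pred; _∈_; _∉_; _⊆_; _≐_; _∩_; ∁; ⋃; U; _⊢_)

private
  variable
    ℓ ℓ′ : Level
    A B X Y Z : Set

-- Countable sets

-- This is the coding `2^a * (2 * b + 1) - 1`. Parity reveals whether `a` is zero.
pair : ℕ → ℕ → ℕ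
pair zero    b = 2 ℕ.* b
pair (suc a) b = suc (2 ℕ.* pair a b)

pair-injective : ∀ a a′ {b b′} → pair a b ≡ pair a′ b′ → (a , b) ≡ (a′ , b′)
pair-injective zero    zero     {b} {b′} eq = cong (0 ,_) (ℕ.*-cancelˡ-≡ b b′ 2 eq)
pair-injective zero    (suc a′) {b} {b′} eq = contradiction eq (ℕ.even≢odd b (pair a′ b′))
pair-injective (suc a) zero     {b} {b′} eq = contradiction (sym eq) (ℕ.even≢odd b′ (pair a b))
pair-injective (suc a) (suc a′) {b} {b′} eq =
  cong (λ (c , d) → suc c , d)
       (pair-injective a a′ (ℕ.*-cancelˡ-≡ (pair a b) (pair a′ b′) 2 (ℕ.suc-injective eq)))

×-countable : A ↣ ℕ → B ↣ ℕ → (A × B) ↣ ℕ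
×-countable f g = mk↣ {to = λ (a , b) → pair (f.to a) (g.to b)} λ eq →
  let eq′ = pair-injective _ _ eq
  in cong₂ _,_ (f.injective (cong proj₁ eq′)) (g.injective (cong proj₂ eq′))
  where
  module f = Injection f
  module g = Injection g

List-countable : A ↣ ℕ → List A ↣ ℕ
List-countable {A} f = mk↣ {to = code} (λ {xs} {ys} → code-injective xs ys)
  where
  module f = Injection f
  code : List A → ℕ
  code []       = 0
  code (x ∷ xs) = suc (pair (f.to x) (code xs))

  code-injective : ∀ xs ys → code xs ≡ code ys → xs ≡ ys
  code-injective []       []       _  = refl
  code-injective (x ∷ xs) (y ∷ ys) eq =
    let eq′ = pair-injective _ _ (ℕ.suc-injective eq)
    in cong₂ _∷_ (f.injective (cong proj₁ eq′)) (code-injective xs ys (cong proj₂ eq′))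

ℕ-countable : ℕ ↣ ℕ
ℕ-countable = mk↣ id

Bool-countable : Bool ↣ ℕ
Bool-countable = mk↣ {to = if_then 1 else 0} (λ {a} {b} → injective a b)
  where
  injective : ∀ a b → (if a then 1 else 0) ≡ (if b then 1 else 0) → a ≡ b
  injective true  true  _ = refl
  injective false false _ = refl

ℤ-countable : ℤ ↣ ℕ
ℤ-countable = mk↣ {to = code} (λ {i} {j} → code-injective i j)
  where
  code : ℤ → ℕ
  code (+ n)    = pair 0 n
  code -[1+ n ] = pair 1 n

  code-injective : ∀ i j → code i ≡ code j → i ≡ j
  code-injective (+ m)    (+ n)    eq = cong (+_ ∘ proj₂) (pair-injective 0 0 {m} {n} eq)
  code-injective (+ m)    -[1+ n ] eq =
    contradiction (cong proj₁ (pair-injective 0 1 {m} {n} eq)) λ ()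
  code-injective -[1+ m ] (+ n)    eq =
    contradiction (cong proj₁ (pair-injective 1 0 {m} {n} eq)) λ ()
  code-injective -[1+ m ] -[1+ n ] eq = cong (-[1+_] ∘ proj₂) (pair-injective 1 1 {m} {n} eq)

ℚ-countable : ℚ ↣ ℕ
ℚ-countable = mk↣ {to = λ q → zd.to (ℚ.numerator q , ℚ.denominator-1 q)} λ {p} {q} eq →
  same p q (zd.injective eq)
  where
  module zd = Injection (×-countable ℤ-countable ℕ-countable)
  same : ∀ p q → (ℚ.numerator p , ℚ.denominator-1 p) ≡ (ℚ.numerator q , ℚ.denominator-1 q) → p ≡ q
  -- The coprimality field is irrelevant, so numerator and denominator determine the rational.
  same (mkℚ _ _ _) (mkℚ _ _ _) refl = refl

-- Topology

module _ (𝒯 : Topology Z) where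

  -- The set is the union of the chosen neighbourhoods, indexed by its own points; this index type
  -- is small, as `open-⋃` demands.
  open-local : ∀ {A : Pred Z 0ℓ} →
    (∀ {z} → z ∈ A → ∃ λ V → Open 𝒯 V × z ∈ V × V ⊆ A) → Open 𝒯 A
  open-local {A} h = Topology.open-resp 𝒯
    ((λ ((_ , z∈A) , y∈V) → let _ , _ , _ , V⊆A = h z∈A in V⊆A y∈V) ,
     (λ z∈A → let _ , _ , z∈V , _ = h z∈A in (_ , z∈A) , z∈V))
    (Topology.open-⋃ 𝒯 {I = ∃ λ z → z ∈ A} {A = λ (_ , z∈A) → proj₁ (h z∈A)}
      (λ (_ , z∈A) → proj₁ (proj₂ (h z∈A))))

  -- Continuity into the discrete space on `A`, stated without a topology on `A`.
  LocallyConstant : (Z → A) → Set₁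
  LocallyConstant g = ∀ z → ∃ λ V → Open 𝒯 V × z ∈ V × (∀ {y} → y ∈ V → g y ≡ g z)

  const-lc : (a : A) → LocallyConstant (λ _ → a)
  const-lc _ _ = U , Topology.open-U 𝒯 , tt , λ _ → refl

  lift₂-lc : {C : Set} {g : Z → A} {h : Z → B} (k : A → B → C) →
    LocallyConstant g → LocallyConstant h → LocallyConstant (λ z → k (g z) (h z))
  lift₂-lc k g-lc h-lc z =
    let V , oV , z∈V , V-const = g-lc z
        W , oW , z∈W , W-const = h-lc z
    in V ∩ W , Topology.open-∩ 𝒯 oV oW , (z∈V , z∈W) ,
       λ (y∈V , y∈W) → cong₂ k (V-const y∈V) (W-const y∈W)

  lift-lc : {g : Z → A} (k : A → B) → LocallyConstant g → LocallyConstant (k ∘ g)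
  lift-lc k g-lc = lift₂-lc (λ a _ → k a) g-lc (const-lc tt)

  fiber-open : {g : Z → A} → LocallyConstant g → ∀ a → Open 𝒯 (λ z → g z ≡ a)
  fiber-open g-lc a = open-local λ {z} gz≡a →
    let V , oV , z∈V , V-const = g-lc z in V , oV , z∈V , λ y∈V → trans (V-const y∈V) gz≡a

product-continuous : {𝒮 : Topology Y} {f : Y → 𝒫 X} →
  (∀ x → LocallyConstant 𝒮 (λ y → f y x)) → Continuous 𝒮 (product X) f
product-continuous {Y} {X} {𝒮} {f} f-lc V oV = open-local 𝒮 λ {y} fy∈V →
  let is , fy∈ , ⊆V = oV fy∈V
      W , oW , y∈W , W⊆ = nbhd is fy∈
  in W , oW , y∈W , λ w → ⊆V (W⊆ w)
  where
  Agrees : List (X × Bool) → Y → Set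
  Agrees is y = All (λ (x , b) → f y x ≡ b) is

  nbhd : ∀ {y} is → Agrees is y → ∃ λ W → Open 𝒮 W × y ∈ W × W ⊆ Agrees is
  nbhd []             []         = U , Topology.open-U 𝒮 , tt , λ _ → []
  nbhd ((x , b) ∷ is) (eq ∷ eqs) =
    let W , oW , y∈W , W⊆ = nbhd is eqs
    in _ , Topology.open-∩ 𝒮 (fiber-open 𝒮 (f-lc x) b) oW , (eq , y∈W) ,
       λ (z∈ , z∈W) → z∈ ∷ W⊆ z∈W

-- Real numbers

half+half : ∀ p → ½ ℚ.* p ℚ.+ ½ ℚ.* p ≡ p
half+half p = trans (sym (ℚ.*-distribʳ-+ p ½ ½)) (ℚ.*-identityˡ p)

half-positive : ∀ {p} → 0ℚ ℚ.< p → 0ℚ ℚ.< ½ ℚ.* p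
half-positive {p} 0<p =
  subst (ℚ._< ½ ℚ.* p) (ℚ.*-zeroʳ ½) (ℚ.*-monoʳ-<-pos ½ 0<p)

gap : ∀ {p r} → p ℚ.< r → ∃ λ ε → 0ℚ ℚ.< ε × p ℚ.+ ε ℚ.< r
gap {p} {r} p<r =
  let m , p<m , m<r = ℚ.<-dense p<r
  in m ℚ.- p ,
     subst (ℚ._< m ℚ.- p) (ℚ.+-inverseʳ p) (ℚ.+-monoˡ-< (ℚ.- p) p<m) ,
     subst (ℚ._< r) (sym (p+[m-p]≡m m)) m<r
  where
  p+[m-p]≡m : ∀ m → p ℚ.+ (m ℚ.- p) ≡ m
  p+[m-p]≡m m = trans (cong (p ℚ.+_) (ℚ.+-comm m (ℚ.- p)))
    (trans (sym (ℚ.+-assoc p (ℚ.- p) m))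
    (trans (cong (ℚ._+ m) (ℚ.+-inverseʳ p)) (ℚ.+-identityˡ m)))

-- Built directly in lowest terms, so that its `denominator-1` is `N` by computation.
1/suc : ℕ → ℚ
1/suc N = mkℚ (+ 1) N (1-coprimeTo (suc N))

-- For `p = (a + 1) / (d + 1)`, cross-multiplication gives `(a + 1) * (N + 1) < d + 1`. So
-- denominators tend to infinity as positive rationals tend to zero.
<1/suc⇒≤denominator-1 : ∀ {N p} → 0ℚ ℚ.< p → p ℚ.< 1/suc N → N ℕ.≤ ℚ.denominator-1 p
<1/suc⇒≤denominator-1 {N} {mkℚ (+ zero)  d _} (ℚ.*<* (ℤ.+<+ ())) _
<1/suc⇒≤denominator-1 {N} {mkℚ (+ suc a) d _} _ (ℚ.*<* (ℤ.+<+ lt)) =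
  ℕ.s≤s⁻¹ (ℕ.≤-trans (ℕ.m≤m+n (suc N) (a ℕ.* suc N))
                     (ℕ.≤-trans (ℕ.<⇒≤ lt) (ℕ.≤-reflexive (ℕ.*-identityˡ (suc d)))))
<1/suc⇒≤denominator-1 {N} {mkℚ -[1+ a ]  d _} (ℚ.*<* ()) _

-- Cantor space

Agree : ℕ → (ℕ → A) → (ℕ → A) → Set
Agree N x y = ∀ i → i ℕ.< N → x i ≡ y i

Agree-mono : ∀ {M N} {x y : ℕ → A} → M ℕ.≤ N → Agree N x y → Agree M x y
Agree-mono M≤N x~y i i<M = x~y i (ℕ.≤-trans i<M M≤N)

Agree-sym : ∀ {N} {x y : ℕ → A} → Agree N x y → Agree N y x
Agree-sym x~y i i<N = sym (x~y i i<N)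

Agree-trans : ∀ {N} {x y z : ℕ → A} → Agree N x y → Agree N y z → Agree N x z
Agree-trans x~y y~z i i<N = trans (x~y i i<N) (y~z i i<N)

cantorOpen⇒cylinder : ∀ {V} → Open (product ℕ) V → ∀ {x} → x ∈ V →
  ∃ λ N → (∀ {y} → Agree N x y → y ∈ V)
cantorOpen⇒cylinder oV {x} x∈V =
  let is , x∈ , ⊆V = oV x∈V
      N , N⊆ = bound is x∈
  in N , λ x~y → ⊆V (N⊆ x~y)
  where
  Satisfies : List (ℕ × Bool) → 𝒫 ℕ → Set
  Satisfies is y = All (λ (i , b) → y i ≡ b) is

  bound : ∀ is → Satisfies is x → ∃ λ N → (∀ {y} → Agree N x y → Satisfies is y)
  bound []             []         = 0 , λ _ → []
  bound ((i , b) ∷ is) (eq ∷ eqs) =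
    let N , N⊆ = bound is eqs
    in suc i ℕ.⊔ N , λ x~y →
         trans (sym (x~y i (ℕ.m≤m⊔n (suc i) N))) eq ∷
         N⊆ (Agree-mono (ℕ.m≤n⊔m (suc i) N) x~y)

cylinder-open : ∀ N x → Open (product ℕ) (Agree N x)
cylinder-open zero    x = λ _ → [] , [] , λ _ _ ()
cylinder-open (suc N) x = Topology.open-resp (product ℕ)
  ((λ (x~y , xN≡yN) i i<1+N → case ℕ.m≤n⇒m<n∨m≡n (ℕ.s≤s⁻¹ i<1+N) of λ where
      (inj₁ i<N)  → x~y i i<N
      (inj₂ refl) → sym xN≡yN) ,
   (λ x~y → Agree-mono (ℕ.n≤1+n N) x~y , sym (x~y N ℕ.≤-refl)))
  (Topology.open-∩ (product ℕ) (cylinder-open N x)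
    (λ {y} yN≡xN → (N , x N) ∷ [] , yN≡xN ∷ [] , All.head))

cylinder⇒cantorOpen : ∀ {V} → (∀ {x} → x ∈ V → ∃ λ N → (∀ {y} → Agree N x y → y ∈ V)) →
  Open (product ℕ) V
cylinder⇒cantorOpen cyl = open-local (product ℕ) λ {x} x∈V →
  let N , N⊆V = cyl x∈V in Agree N x , cylinder-open N x , (λ _ _ → refl) , N⊆V

-- The distance is the infimum of the p > 0 with Agree (denominator-1 p) x y;
-- any function ℚ → ℕ that vanishes somewhere and tends to infinity at 0⁺
-- could replace the denominator.
cantorDist : 𝒫 ℕ → 𝒫 ℕ → ℝ
cantorDist x y = record
  { Above     = λ q → ∃ λ p → 0ℚ ℚ.< p × p ℚ.< q × Agree (ℚ.denominator-1 p) x y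
  ; inhabited = 1ℚ ℚ.+ 1ℚ , 1ℚ , ℚ.positive⁻¹ 1ℚ , ℚ.*<* (ℤ.+<+ (s≤s (s≤s z≤n))) , λ _ ()
  ; bounded   = 0ℚ , λ (_ , 0<p , p<q , _) → ℚ.<⇒≤ (ℚ.<-trans 0<p p<q)
  ; upward    = λ q<r (p , 0<p , p<q , x~y) → p , 0<p , ℚ.<-trans p<q q<r , x~y
  ; rounded   = λ (p , 0<p , p<q , x~y) →
      let m , p<m , m<q = ℚ.<-dense p<q in m , m<q , p , 0<p , p<m , x~y
  }

cantorDist-small : ∀ {N x y} → cantorDist x y <ʳ 1/suc N → Agree N x y
cantorDist-small (p , 0<p , p<1/N , x~y) = Agree-mono (<1/suc⇒≤denominator-1 0<p p<1/N) x~y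

cantorDist-agree : ∀ {ε} → 0ℚ ℚ.< ε →
  ∃ λ N → ∀ {x y} → Agree N x y → cantorDist x y <ʳ ε
cantorDist-agree 0<ε =
  let p , 0<p , p<ε = ℚ.<-dense 0<ε
  in ℚ.denominator-1 p , λ x~y → p , 0<p , p<ε , x~y

0<1/suc : ∀ N → 0ℚ ℚ.< 1/suc N
0<1/suc N = ℚ.positive⁻¹ (1/suc N)

infix 4 _≗_
_≗_ : 𝒫 ℕ → 𝒫 ℕ → Set
x ≗ y = ∀ i → x i ≡ y i

cantorDist-isMetric : IsMetric _≗_ cantorDist
cantorDist-isMetric = record
  { isSemiMetric = record
    { isQuasiSemiMetric = record
      { isPreMetric = record
        { isProtoMetric = record
          { isPartialOrder  = record
            { isPreorder = record
              { isEquivalence = record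
                { refl  = id , id
                ; sym   = λ (f , g) → g , f
                ; trans = λ (f , g) (h , k) → (λ z → h (f z)) , (λ z → g (k z))
                }
              ; reflexive = proj₂
              ; trans     = λ f g z → f (g z)
              }
            ; antisym = λ f g → g , f
            }
          ; ≈-isEquivalence = record
            { refl  = λ _ → refl
            ; sym   = λ x≗y i → sym (x≗y i)
            ; trans = λ x≗y y≗z i → trans (x≗y i) (y≗z i)
            }
          ; cong        = λ x≗y u≗v →
              dist-⊆ x≗y u≗v , dist-⊆ (λ i → sym (x≗y i)) (λ i → sym (u≗v i))
          ; nonNegative = λ (p , 0<p , p<q , _) → ℚ.<-trans 0<p p<q
          }
        ; ≈⇒0 = λ x≗y →
            (λ (p , 0<p , p<q , _) → ℚ.<-trans 0<p p<q) ,
            (λ 0<q → proj₂ (cantorDist-agree 0<q) (λ i _ → x≗y i))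
        }
      -- Coordinate `i` is settled by agreement below `suc i`.
      ; 0⇒≈ = λ (_ , 0⊆) i → cantorDist-small (0⊆ (0<1/suc (suc i))) i ℕ.≤-refl
      }
    ; sym = λ _ _ → dist-sym , dist-sym
    }
  ; triangle = λ _ _ _ → dist-triangle
  }
  where
  dist-⊆ : ∀ {x y u v} → x ≗ y → u ≗ v → cantorDist y v ≤ cantorDist x u
  dist-⊆ x≗y u≗v (p , 0<p , p<q , x~u) =
    p , 0<p , p<q , λ i i< → trans (sym (x≗y i)) (trans (x~u i i<) (u≗v i))

  dist-sym : ∀ {x y} → cantorDist y x ≤ cantorDist x y
  dist-sym (p , 0<p , p<q , x~y) = p , 0<p , p<q , Agree-sym x~y

  <-+ : ∀ {p r s} → p ℚ.< r → 0ℚ ℚ.< s → p ℚ.< r ℚ.+ s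
  <-+ {p} p<r 0<s = subst (ℚ._< _) (ℚ.+-identityʳ p) (ℚ.+-mono-< p<r 0<s)

  -- The witness with the smaller denominator serves for `x` and `z`, since the longer of the two
  -- agreements restricts to it.
  dist-triangle : ∀ {x y z} → cantorDist x z ≤ cantorDist x y + cantorDist y z
  dist-triangle (r , s , (p , 0<p , p<r , x~y) , (p′ , 0<p′ , p′<s , y~z) , r+s<q)
    with ℕ.≤-total (ℚ.denominator-1 p) (ℚ.denominator-1 p′)
  ... | inj₁ le = p , 0<p , ℚ.<-trans (<-+ p<r (ℚ.<-trans 0<p′ p′<s)) r+s<q ,
                  Agree-trans x~y (Agree-mono le y~z)
  ... | inj₂ ge = p′ , 0<p′ ,
                  ℚ.<-trans (subst (p′ ℚ.<_) (ℚ.+-comm s r) (<-+ p′<s (ℚ.<-trans 0<p p<r)))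
                            r+s<q ,
                  Agree-trans (Agree-mono ge x~y) y~z

-- Coordinate `i` of a Cauchy sequence is constant from `stage (suc i)` on, and the limit takes this
-- final value.
cantorDist-complete : Complete cantorDist
cantorDist-complete s cauchy = limit , λ ε 0<ε →
  let N , small = cantorDist-agree 0<ε
      M , M-conv = converges N
  in M , λ n M≤n → small (M-conv n M≤n)
  where
  stage : ℕ → ℕ
  stage N = proj₁ (cauchy (1/suc N) (0<1/suc N))

  stage-agree : ∀ N {m n} → stage N ℕ.≤ m → stage N ℕ.≤ n → Agree N (s m) (s n)
  stage-agree N ≤m ≤n = cantorDist-small (proj₂ (cauchy (1/suc N) (0<1/suc N)) _ _ ≤m ≤n)

  limit : 𝒫 ℕ
  limit i = s (stage (suc i)) i

  converges : ∀ N → ∃ λ M → ∀ n → M ℕ.≤ n → Agree N (s n) limit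
  converges zero    = 0 , λ _ _ _ ()
  converges (suc N) =
    let M , M-conv = converges N
    -- The stages need not increase, so agreement is extended one coordinate at a time by taking
    -- maxima.
    in stage (suc N) ℕ.⊔ M , λ n ≤n i i<1+N →
         case ℕ.m≤n⇒m<n∨m≡n (ℕ.s≤s⁻¹ i<1+N) of λ where
           (inj₁ i<N)  → M-conv n (ℕ.m⊔n≤o⇒n≤o (stage (suc N)) M ≤n) i i<N
           (inj₂ refl) → stage-agree (suc N) (ℕ.m⊔n≤o⇒m≤o (stage (suc N)) M ≤n)
                                     ℕ.≤-refl N ℕ.≤-refl

prefix : ℕ → 𝒫 ℕ → List Bool
prefix zero    x = []
prefix (suc n) x = x 0 ∷ prefix n (x ∘ suc)

fromPrefix : List Bool → 𝒫 ℕ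
fromPrefix []       _       = false
fromPrefix (b ∷ bs) zero    = b
fromPrefix (b ∷ bs) (suc i) = fromPrefix bs i

fromPrefix-prefix : ∀ N x → Agree N x (fromPrefix (prefix N x))
fromPrefix-prefix (suc N) x zero    _         = refl
fromPrefix-prefix (suc N) x (suc i) (s≤s i<N) = fromPrefix-prefix N (x ∘ suc) i i<N

cantor-polish : Polish (product ℕ)
cantor-polish =
  (List Bool , fromPrefix , List-countable Bool-countable , λ x V oV x∈V →
     let N , N⊆V = cantorOpen⇒cylinder oV x∈V
     in fromPrefix (prefix N x) , N⊆V (fromPrefix-prefix N x) , prefix N x , refl) ,
  (_≗_ , cantorDist , cantorDist-isMetric , cantorDist-complete , λ V → mk⇔ to from)
  where
  BallsIn : Pred (𝒫 ℕ) 0ℓ → Set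
  BallsIn V = ∀ {x} → x ∈ V → ∃ λ ε → 0ℚ ℚ.< ε × (λ y → cantorDist x y <ʳ ε) ⊆ V

  to : ∀ {V} → Open (product ℕ) V → BallsIn V
  to oV x∈V = let N , N⊆V = cantorOpen⇒cylinder oV x∈V
              in 1/suc N , 0<1/suc N , λ d< → N⊆V (cantorDist-small d<)

  from : ∀ {V} → BallsIn V → Open (product ℕ) V
  from balls = cylinder⇒cantorOpen λ x∈V →
    let ε , 0<ε , ball⊆V = balls x∈V
        N , small = cantorDist-agree 0<ε
    in N , λ x~y → ball⊆V (small x~y)

cantor-zeroDimensional : ZeroDimensional (product ℕ)
cantor-zeroDimensional V oV {x} x∈V =
  let N , N⊆V = cantorOpen⇒cylinder oV x∈V
  in Agree N x , cylinder-open N x ,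
     -- Disagreement below `N` is itself decided by the first `N` coordinates.
     cylinder⇒cantorOpen (λ x≁y → N , λ y~z x~z → x≁y (Agree-trans x~z (Agree-sym y~z))) ,
     (λ _ _ → refl) , N⊆V

-- Classical reasoning

module Classical (em : ∀ {ℓ} {P : Set ℓ} → Dec P) where

  by-contradiction : {P : Set ℓ} → ¬ ¬ P → P
  by-contradiction = decidable-stable em

  ¬∀⇒∃¬ : {I : Set ℓ} {P : I → Set ℓ′} → ¬ (∀ i → P i) → ∃ λ i → ¬ P i
  ¬∀⇒∃¬ ¬∀ = by-contradiction λ ¬∃ → ¬∀ λ i → by-contradiction λ ¬p → ¬∃ (i , ¬p)

  -- An implication is a product indexed by the proofs of `P`, so this is an instance of `¬∀⇒∃¬`.
  ¬[→]⇒×¬ : {P : Set ℓ} {Q : Set ℓ′} → ¬ (P → Q) → P × ¬ Q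
  ¬[→]⇒×¬ = ¬∀⇒∃¬

  enumeration : (c : A ↣ ℕ) → A → ∃ λ (e : ℕ → A) → ∀ a → e (Injection.to c a) ≡ a
  enumeration {A} c a₀ = e , e-to
    where
    module c = Injection c
    e : ℕ → A
    e k with em {P = ∃ λ a → c.to a ≡ k}
    ... | yes (a , _) = a
    ... | no _        = a₀

    e-to : ∀ a → e (c.to a) ≡ a
    e-to a with em {P = ∃ λ b → c.to b ≡ c.to a}
    ... | yes (b , eq) = c.injective eq
    ... | no ¬∃        = contradiction (a , refl) ¬∃

  -- Baire category in Cantor space

  EventuallyFalse : Pred (𝒫 ℕ) 0ℓ
  EventuallyFalse x = ∃ λ N → ∀ m → N ℕ.≤ m → x m ≡ false

  -- A Baire construction: step `k` fixes a longer initial segment that forces membership in the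
  -- `O i` with code `k`, and then writes one further `true`. The limit lies in every `O i` and is
  -- `true` infinitely often.
  eventuallyFalse-notGδ : {I : Set} {O : I → Pred (𝒫 ℕ) 0ℓ} → AtMostCountable I →
    (∀ i → Open (product ℕ) (O i)) → (∀ i → EventuallyFalse ⊆ O i) →
    ∃ λ x → (∀ i → x ∈ O i) × x ∉ EventuallyFalse
  eventuallyFalse-notGδ {I} {O} c O-open ⊆O = x , x∈O , x∉
    where
    module c = Injection c

    -- The values below `n` are final. Being `false` from `n` on puts `g` in `EventuallyFalse`,
    -- hence in every `O i`, so there is always a cylinder about `g` to pass to.
    State : Set
    State = Σ[ g ∈ 𝒫 ℕ ] Σ[ n ∈ ℕ ] (∀ i → n ℕ.≤ i → g i ≡ false)

    Next : ℕ → State → State → Set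
    Next k (g , n , _) (g′ , n′ , _) = ∃ λ M → n ℕ.≤ M × n′ ≡ suc M × Agree M g g′ × g′ M ≡ true ×
      (∀ i → c.to i ≡ k → ∀ {y} → Agree M g y → y ∈ O i)

    radius : ∀ k (s : State) → ∃ λ N → ∀ i → c.to i ≡ k → ∀ {y} → Agree N (proj₁ s) y → y ∈ O i
    radius k (g , n , g-false) with em {P = ∃ λ i → c.to i ≡ k}
    -- No index has code `k`, so every radius works.
    ... | no ¬∃ = 0 , λ i eq → contradiction (i , eq) ¬∃
    ... | yes (i , refl) =
      let N , N⊆O = cantorOpen⇒cylinder (O-open i) (⊆O i (n , g-false))
      in N , λ j eq a → subst (λ j → _ ∈ O j) (sym (c.injective eq)) (N⊆O a)

    set : ℕ → 𝒫 ℕ → 𝒫 ℕ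
    set M g i with i ℕ.≟ M
    ... | yes _ = true
    ... | no _  = g i

    set-≡ : ∀ M g → set M g M ≡ true
    set-≡ M g with M ℕ.≟ M
    ... | yes _  = refl
    ... | no M≢M = contradiction refl M≢M

    set-≢ : ∀ M g i → i ≢ M → set M g i ≡ g i
    set-≢ M g i i≢M with i ℕ.≟ M
    ... | yes i≡M = contradiction i≡M i≢M
    ... | no _    = refl

    next : ∀ k s → ∃ (Next k s)
    next k s@(g , n , g-false) =
      let N , N⊆O = radius k s
          M       = n ℕ.⊔ N
          n≤M     = ℕ.m≤m⊔n n N
      in (set M g , suc M , λ i M<i →
            trans (set-≢ M g i (ℕ.>⇒≢ M<i)) (g-false i (ℕ.≤-trans n≤M (ℕ.<⇒≤ M<i)))) ,
         M , n≤M , refl , (λ i i<M → sym (set-≢ M g i (ℕ.<⇒≢ i<M))) , set-≡ M g ,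
         λ i eq a → N⊆O i eq (Agree-mono (ℕ.m≤n⊔m n N) a)

    state : ℕ → State
    state zero    = (λ _ → false) , 0 , λ _ _ → refl
    state (suc k) = proj₁ (next k (state k))

    g : ℕ → 𝒫 ℕ
    g k = proj₁ (state k)

    n : ℕ → ℕ
    n k = proj₁ (proj₂ (state k))

    spec : ∀ k → Next k (state k) (state (suc k))
    spec k = proj₂ (next k (state k))

    n-< : ∀ k → n k ℕ.< n (suc k)
    n-< k = let _ , n≤M , n′≡ , _ = spec k in subst (n k ℕ.<_) (sym n′≡) (s≤s n≤M)

    k≤n : ∀ k → k ℕ.≤ n k
    k≤n zero    = z≤n
    k≤n (suc k) = ℕ.≤-<-trans (k≤n k) (n-< k)

    g-step : ∀ k → Agree (n k) (g k) (g (suc k))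
    g-step k = let _ , n≤M , _ , g~g′ , _ = spec k in Agree-mono n≤M g~g′

    g-agree : ∀ {j k} → j ℕ.≤′ k → n j ℕ.≤ n k × Agree (n j) (g j) (g k)
    g-agree ℕ.≤′-refl                   = ℕ.≤-refl , λ _ _ → refl
    g-agree (ℕ.≤′-step {n = k} j≤k) =
      let nj≤nk , gj~gk = g-agree j≤k
      in ℕ.≤-trans nj≤nk (ℕ.<⇒≤ (n-< k)) , Agree-trans gj~gk (Agree-mono nj≤nk (g-step k))

    -- Since `i < suc i ≤ n (suc i)`, coordinate `i` is already final at stage `suc i`.
    x : 𝒫 ℕ
    x i = g (suc i) i

    g~x : ∀ k → Agree (n k) (g k) x
    g~x k i i<n with ℕ.≤-total k (suc i)
    ... | inj₁ k≤1+i = proj₂ (g-agree (ℕ.≤⇒≤′ k≤1+i)) i i<n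
    ... | inj₂ 1+i≤k = sym (proj₂ (g-agree (ℕ.≤⇒≤′ 1+i≤k)) i (k≤n (suc i)))

    x∈O : ∀ i → x ∈ O i
    x∈O i = let k = c.to i
                M , _ , n′≡ , g~g′ , _ , ⊆Oi = spec k
            in ⊆Oi i refl (Agree-trans g~g′
                 (Agree-mono (ℕ.≤-trans (ℕ.n≤1+n M) (ℕ.≤-reflexive (sym n′≡))) (g~x (suc k))))

    x∉ : x ∉ EventuallyFalse
    x∉ (k , x-false) =
      -- Step `k` wrote `true` at a position `M ≥ n k ≥ k`, beyond the supposed last `true`.
      let M , n≤M , n′≡ , _ , gM≡true , _ = spec k
          xM≡true = trans (sym (g~x (suc k) M (ℕ.≤-reflexive (sym n′≡)))) gM≡true
      in contradiction (trans (sym xM≡true) (x-false M (ℕ.≤-trans (k≤n k) n≤M))) λ ()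

  -- Zero-dimensional Polish spaces

  module _ {𝒮 : Topology Y} where

    indicator-lc : {W : Pred Y 0ℓ} → Open 𝒮 W → Open 𝒮 (∁ W) →
      LocallyConstant 𝒮 (λ y → does (em {P = y ∈ W}))
    indicator-lc {W} oW o∁W y with em {P = y ∈ W}
    ... | yes y∈W = W , oW , y∈W , λ {z} z∈W → in-W z∈W
      where
      in-W : ∀ {z} → z ∈ W → does (em {P = z ∈ W}) ≡ true
      in-W {z} z∈W with em {P = z ∈ W}
      ... | yes _   = refl
      ... | no z∉W  = contradiction z∈W z∉W
    ... | no y∉W = ∁ W , o∁W , y∉W , λ {z} z∉W → out-W z∉W
      where
      out-W : ∀ {z} → z ∉ W → does (em {P = z ∈ W}) ≡ false
      out-W {z} z∉W with em {P = z ∈ W}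
      ... | yes z∈W = contradiction z∈W z∉W
      ... | no _    = refl

    -- Every open set is a countable union of clopen sets, given by their locally constant
    -- characteristic functions.
    CountablyClopen : Set₁
    CountablyClopen = ∀ {O} → Open 𝒮 O → ∃ λ (D : ℕ → Y → Bool) →
      (∀ k → LocallyConstant 𝒮 (D k)) × (∀ y → y ∈ O ⇔ ∃ λ k → D k y ≡ true)

    -- There are only countably many balls with rational radius about points of the countable dense
    -- set. For each of them, one clopen set between the ball and `O` is chosen whenever there is
    -- one; these cover `O`.
    polish-countablyClopen : Polish 𝒮 → ZeroDimensional 𝒮 → CountablyClopen
    polish-countablyClopen ((I , s , c , s-dense) , (_ , d , metric , _ , induces)) zd {O} oO =
      D , D-lc , λ y → mk⇔ ⇒D (λ (k , Dky) → D⊆O k Dky)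
      where
      open IsGeneralMetric metric using ()
        renaming (sym to d-sym; triangle to d-triangle; ≈⇒0 to d-≈⇒0; module EqC to d-≈)
      open Equivalence
      module c = Injection (×-countable c ℚ-countable)

      ball : Y → ℚ → Pred Y 0ℓ
      ball y ε z = d y z <ʳ ε

      d-< : ∀ {x y z p q r} → d x y <ʳ p → d y z <ʳ q → p ℚ.+ q ℚ.< r → d x z <ʳ r
      d-< x<p y<q p+q<r = d-triangle _ _ _ (_ , _ , x<p , y<q , p+q<r)

      ball-open : ∀ y ε → Open 𝒮 (ball y ε)
      ball-open y ε = from (induces (ball y ε)) λ {z} yz<ε →
        let p , p<ε , yz<p = rounded (d y z) yz<ε
            δ , 0<δ , p+δ<ε = gap p<ε
        in δ , 0<δ , λ zw<δ → d-< yz<p zw<δ p+δ<ε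

      centre : ∀ y {ε} → 0ℚ ℚ.< ε → d y y <ʳ ε
      centre y = proj₂ (d-≈⇒0 d-≈.refl)

      Candidate : ℕ → Pred Y 0ℓ → Set
      Candidate k W = Open 𝒮 W × Open 𝒮 (∁ W) × W ⊆ O ×
        (∃ λ i → ∃ λ q → c.to (i , q) ≡ k × ball (s i) q ⊆ W)

      D : ℕ → Y → Bool
      D k y with em {P = ∃ (Candidate k)}
      ... | yes (W , _) = does (em {P = y ∈ W})
      -- The empty set stands in when no clopen set fits.
      ... | no _        = false

      D-lc : ∀ k → LocallyConstant 𝒮 (D k)
      D-lc k with em {P = ∃ (Candidate k)}
      ... | yes (W , oW , o∁W , _) = indicator-lc oW o∁W
      ... | no _                   = const-lc 𝒮 false

      D⊆O : ∀ k {y} → D k y ≡ true → y ∈ O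
      D⊆O k {y} Dky with em {P = ∃ (Candidate k)}
      D⊆O k {y} Dky | yes (W , _ , _ , W⊆O , _) with em {P = y ∈ W}
      D⊆O k {y} Dky | yes (W , _ , _ , W⊆O , _) | yes y∈W = W⊆O y∈W

      D-ball : ∀ {W} i q {y} → Open 𝒮 W → Open 𝒮 (∁ W) → W ⊆ O → ball (s i) q ⊆ W →
        y ∈ ball (s i) q →
        D (c.to (i , q)) y ≡ true
      D-ball {W} i q {y} oW o∁W W⊆O b⊆W y∈b with em {P = ∃ (Candidate (c.to (i , q)))}
      ... | no ¬∃ = contradiction (W , oW , o∁W , (λ {_} → W⊆O) , i , q , refl , (λ {_} → b⊆W)) ¬∃
      -- The chosen `W′` may differ from `W`, but it contains the same ball.
      ... | yes (W′ , _ , _ , _ , i′ , q′ , eq , b⊆W′)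
        with em {P = y ∈ W′} | c.injective {i′ , q′} {i , q} eq
      ...   | yes _    | _    = refl
      ...   | no y∉W′  | refl = contradiction (b⊆W′ y∈b) y∉W′

      ⇒D : ∀ {y} → y ∈ O → ∃ λ k → D k y ≡ true
      ⇒D {y} y∈O =
        let W , oW , o∁W , y∈W , W⊆O = zd O oO y∈O
            ε , 0<ε , b⊆W = to (induces W) oW y∈W
            p , 0<p , p<ε = ℚ.<-dense 0<ε
            -- A centre within `q` of `y` has its `q`-ball inside the `ε`-ball about `y`, because
            -- `q + q = p < ε`.
            q = ½ ℚ.* p
            x , yx<q , i , si≡x = s-dense y (ball y q) (ball-open y q) (centre y (half-positive 0<p))
            ysi<q = subst (λ x → d y x <ʳ q) (sym si≡x) yx<q
        in c.to (i , q) ,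
           D-ball i q oW o∁W W⊆O
             (λ siz<q → b⊆W (d-< ysi<q siz<q (subst (ℚ._< ε) (sym (half+half p)) p<ε)))
             (proj₁ (d-sym y (s i)) ysi<q)

  -- Coding Σ⁰₂ sets by finiteness

  -- A Boolean test for the least `k` with `g k` true. It inspects only finitely many values of `g`,
  -- so local constancy carries over.
  firstHit : 𝒫 ℕ → ℕ → Bool
  firstHit g zero    = g 0
  firstHit g (suc k) = not (g 0) ∧ firstHit (g ∘ suc) k

  ∧-true : ∀ {a b} → a ∧ b ≡ true → a ≡ true × b ≡ true
  ∧-true {true} {true} _ = refl , refl

  firstHit-sound : ∀ g k → firstHit g k ≡ true → g k ≡ true
  firstHit-sound g zero    eq = eq
  firstHit-sound g (suc k) eq = firstHit-sound (g ∘ suc) k (proj₂ (∧-true eq))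

  firstHit-unique : ∀ g j k → firstHit g j ≡ true → firstHit g k ≡ true → j ≡ k
  firstHit-unique g zero    zero    _  _  = refl
  firstHit-unique g zero    (suc k) hj hk =
    contradiction (trans (sym (proj₁ (∧-true hk))) (cong not hj)) λ ()
  firstHit-unique g (suc j) zero    hj hk =
    contradiction (trans (sym (proj₁ (∧-true hj))) (cong not hk)) λ ()
  firstHit-unique g (suc j) (suc k) hj hk =
    cong suc (firstHit-unique (g ∘ suc) j k (proj₂ (∧-true hj)) (proj₂ (∧-true hk)))

  firstHit-exists : ∀ g k → g k ≡ true → ∃ λ j → firstHit g j ≡ true
  firstHit-exists g zero    hit = 0 , hit
  firstHit-exists g (suc k) hit with g 0 in g0
  ... | true  = 0 , g0
  ... | false =
    let j , hj = firstHit-exists (g ∘ suc) k hit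
    in suc j , trans (cong (λ b → not b ∧ firstHit (g ∘ suc) j) g0) hj

  -- κ lists, last row first, the positions of the first hits in an initial
  -- segment of the rows of D.
  Hits : (ℕ → 𝒫 ℕ) → List ℕ → Bool
  Hits D []      = true
  Hits D (k ∷ κ) = firstHit (D (length κ)) k ∧ Hits D κ

  Hits-unique : ∀ {D} κ κ′ → length κ ≡ length κ′ → Hits D κ ≡ true → Hits D κ′ ≡ true → κ ≡ κ′
  Hits-unique         []      []        _  _ _  = refl
  Hits-unique {D} (k ∷ κ) (k′ ∷ κ′) eq h h′
    with refl ← Hits-unique {D} κ κ′ (ℕ.suc-injective eq) (proj₂ (∧-true h)) (proj₂ (∧-true h′)) =
    cong (_∷ κ) (firstHit-unique (D (length κ)) k k′ (proj₁ (∧-true h)) (proj₁ (∧-true h′)))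

  Hits-hit : ∀ {D} κ {j} → Hits D κ ≡ true → j ℕ.< length κ → ∃ λ k → D j k ≡ true
  Hits-hit {D} (k ∷ κ) h j<1+n with ℕ.m≤n⇒m<n∨m≡n (ℕ.s≤s⁻¹ j<1+n)
  ... | inj₁ j<n  = Hits-hit κ (proj₂ (∧-true h)) j<n
  ... | inj₂ refl = k , firstHit-sound (D (length κ)) k (proj₁ (∧-true h))

  -- A list of hits cannot pass the row without a hit, so its length is at most `j`, and each length
  -- admits at most one such list.
  Hits-finite : ∀ {D j} → (∀ k → D j k ≡ false) → ∃ λ L → ∀ κ → Hits D κ ≡ true → κ ∈ₗ L
  Hits-finite {D} {j} missed =
    let L , ∈L = shorter (suc j)
    in L , λ κ h → ∈L κ h (ℕ.≰⇒> λ j<∣κ∣ →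
         let k , hit = Hits-hit κ h j<∣κ∣ in contradiction (trans (sym hit) (missed k)) λ ())
    where
    shorter : ∀ n → ∃ λ L → ∀ κ → Hits D κ ≡ true → length κ ℕ.< n → κ ∈ₗ L
    shorter zero    = [] , λ _ _ ()
    shorter (suc n) with shorter n | em {P = ∃ λ κ → Hits D κ ≡ true × length κ ≡ n}
    ... | L , ∈L | yes (κ₀ , h₀ , len₀) = κ₀ ∷ L , λ κ h <1+n →
          case ℕ.m≤n⇒m<n∨m≡n (ℕ.s≤s⁻¹ <1+n) of λ where
            (inj₁ <n)  → there (∈L κ h <n)
            (inj₂ len) → here (Hits-unique {D} κ κ₀ (trans len (sym len₀)) h h₀)
    ... | L , ∈L | no ¬∃ = L , λ κ h <1+n →
          case ℕ.m≤n⇒m<n∨m≡n (ℕ.s≤s⁻¹ <1+n) of λ where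
            (inj₁ <n)  → ∈L κ h <n
            (inj₂ len) → contradiction (κ , h , len) ¬∃

  Hits-infinite : ∀ {D} → (∀ j → ∃ λ k → D j k ≡ true) →
    ∀ n → ∃ λ κ → length κ ≡ n × Hits D κ ≡ true
  Hits-infinite hit zero = [] , refl , refl
  Hits-infinite {D} hit (suc n) =
    let κ , len , h = Hits-infinite hit n
        k , fh = firstHit-exists (D (length κ)) _ (proj₂ (hit (length κ)))
    in k ∷ κ , cong suc len , cong₂ _∧_ fh h

  Σ⁰₁-open : ∀ {𝒯 : Topology Z} {β A} → β ℕ.< 2 → Σ⁰ 𝒯 β A → Open 𝒯 A
  Σ⁰₁-open _         (open-set o)      = o
  Σ⁰₁-open (s≤s β≤1) (union 2≤β _ _ _) = contradiction (ℕ.≤-trans 2≤β β≤1) λ { (s≤s ()) }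

  module _ {𝒮 : Topology Y} where

    firstHit-lc : {g : Y → 𝒫 ℕ} → (∀ k → LocallyConstant 𝒮 (λ y → g y k)) →
      ∀ k → LocallyConstant 𝒮 (λ y → firstHit (g y) k)
    firstHit-lc g-lc zero    = g-lc 0
    firstHit-lc g-lc (suc k) =
      lift₂-lc 𝒮 (λ a b → not a ∧ b) (g-lc 0) (firstHit-lc (g-lc ∘ suc) k)

    Hits-lc : {D : Y → ℕ → 𝒫 ℕ} → (∀ j k → LocallyConstant 𝒮 (λ y → D y j k)) →
      ∀ κ → LocallyConstant 𝒮 (λ y → Hits (D y) κ)
    Hits-lc D-lc []      = const-lc 𝒮 true
    Hits-lc D-lc (k ∷ κ) =
      lift₂-lc 𝒮 _∧_ (firstHit-lc (D-lc (length κ)) k) (Hits-lc D-lc κ)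

    -- Membership of `y` in `S` becomes finiteness of the set of active codes. Off `S` there are
    -- active codes of every length, and the length will later select a basic open set.
    record Coding (S : Pred Y 0ℓ) : Set₁ where
      field
        code     : List ℕ → Y → Bool
        code-lc  : ∀ κ → LocallyConstant 𝒮 (code κ)
        finite   : ∀ {y} → y ∈ S → ∃ λ L → ∀ κ → code κ y ≡ true → κ ∈ₗ L
        infinite : ∀ {y} → y ∉ S → ∀ n → ∃ λ κ → length κ ≡ n × code κ y ≡ true

    module _ (clopens : CountablyClopen {𝒮 = 𝒮}) where

      -- A normal form for Σ⁰₂ sets: row `j` describes the closed set of those `y` for which no
      -- clopen set of the row is hit.
      Table : Pred Y 0ℓ → Set₁
      Table S = ∃ λ (D : Y → ℕ → 𝒫 ℕ) → (∀ j k → LocallyConstant 𝒮 (λ y → D y j k)) ×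
        (∀ y → y ∈ S ⇔ ∃ λ j → ∀ k → D y j k ≡ false)

      table⇒coding : ∀ {S} → Table S → Coding S
      table⇒coding (D , D-lc , S⇔) = record
        { code     = λ κ y → Hits (D y) κ
        ; code-lc  = Hits-lc D-lc
        ; finite   = λ y∈S → Hits-finite (proj₂ (to (S⇔ _) y∈S))
        ; infinite = λ {y} y∉S → Hits-infinite λ j →
            let k , Djk≢false = ¬∀⇒∃¬ (λ missed → y∉S (from (S⇔ y) (j , missed)))
            in k , Bool.¬-not Djk≢false
        }
        where open Equivalence

      open-table : ∀ {S} → Open 𝒮 S → Table S
      open-table oS =
        let D , D-lc , S⇔ = clopens oS
        -- Each clopen piece is closed, so a single complement, repeated along the row, describes
        -- it.
        in (λ y j _ → not (D j y)) , (λ j _ → lift-lc 𝒮 not (D-lc j)) , λ y → mk⇔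
             (λ y∈S → let j , Djy = to (S⇔ y) y∈S in j , λ _ → cong not Djy)
             (λ (j , h) → from (S⇔ y) (j , Bool.not-injective (h 0)))
        where open Equivalence

      Fσ-table : ∀ {S I} {F : I → Pred Y 0ℓ} → AtMostCountable I → (∀ i → Open 𝒮 (∁ (F i))) →
        S ≐ ⋃ I F → Table S
      Fσ-table {S} {I} {F} c o∁F (S⊆ , ⊆S) =
        (λ y j k → D j k y) , D-lc , λ y → mk⇔ (⇒D ∘ S⊆) (⊆S ∘ D⇒)
        where
        open Equivalence
        module c = Injection c

        D : ℕ → ℕ → Y → Bool
        D j with em {P = ∃ λ i → c.to i ≡ j}
        ... | yes (i , _) = proj₁ (clopens (o∁F i))
        -- A row belonging to no index is hit at once and contributes no point.
        ... | no _        = λ _ _ → true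

        D-lc : ∀ j k → LocallyConstant 𝒮 (D j k)
        D-lc j k with em {P = ∃ λ i → c.to i ≡ j}
        ... | yes (i , _) = proj₁ (proj₂ (clopens (o∁F i))) k
        ... | no _        = const-lc 𝒮 true

        ⇒D : ∀ {y} → y ∈ ⋃ I F → ∃ λ j → ∀ k → D j k y ≡ false
        ⇒D {y} (i , y∈F) = c.to i , row
          where
          row : ∀ k → D (c.to i) k y ≡ false
          row k with em {P = ∃ λ i′ → c.to i′ ≡ c.to i}
          ... | no ¬∃ = contradiction (i , refl) ¬∃
          ... | yes (i′ , eq) with refl ← c.injective eq =
            Bool.¬-not λ hit → from (proj₂ (proj₂ (clopens (o∁F i))) y) (k , hit) y∈F

        D⇒ : ∀ {y} → (∃ λ j → ∀ k → D j k y ≡ false) → y ∈ ⋃ I F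
        D⇒ {y} (j , missed) with em {P = ∃ λ i → c.to i ≡ j}
        ... | no _ = contradiction (missed 0) λ ()
        ... | yes (i , _) = i , by-contradiction λ y∉F →
          let k , hit = to (proj₂ (proj₂ (clopens (o∁F i))) y) y∉F
          in contradiction (trans (sym hit) (missed k)) λ ()

      Σ⁰-coding : ∀ {β S} → β ℕ.< 3 → Σ⁰ 𝒮 β S → Coding S
      Σ⁰-coding _ (open-set oS) = table⇒coding (open-table oS)
      Σ⁰-coding (s≤s β≤2) (union {S} _ c closed S≐) =
        table⇒coding (Fσ-table c (λ i → is-open (closed i)) S≐)
        where
        is-open : ∀ {F} → (∃ λ β′ → 1 ℕ.≤ β′ × β′ ℕ.< _ × Σ⁰ 𝒮 β′ F) → Open 𝒮 F
        is-open (_ , _ , β′<β , σ) = Σ⁰₁-open (ℕ.≤-trans β′<β β≤2) σ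

      Π⁰₃-coding : ∀ {B} → Π⁰ 𝒮 3 B → ∃ λ (S : ℕ → Pred Y 0ℓ) →
        (∀ n → Coding (S n)) × B ≐ (λ y → ∀ n → y ∈ S n)
      Π⁰₃-coding {B} (union {I = I} {B = F} _ c level ∁B≐) = S , S-coding , B⊆ , ⊆B
        where
        module c = Injection c

        S : ℕ → Pred Y 0ℓ
        S n with em {P = ∃ λ i → c.to i ≡ n}
        ... | yes (i , _) = ∁ (F i)
        -- A number coding no index must not restrict the intersection.
        ... | no _        = U

        S-coding : ∀ n → Coding (S n)
        S-coding n with em {P = ∃ λ i → c.to i ≡ n}
        ... | yes (i , _) = let _ , _ , β<3 , σ = level i in Σ⁰-coding β<3 σ
        ... | no _        = table⇒coding (open-table (Topology.open-U 𝒮))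

        B⊆ : ∀ {y} → y ∈ B → ∀ n → y ∈ S n
        B⊆ y∈B n with em {P = ∃ λ i → c.to i ≡ n}
        ... | yes (i , _) = λ y∈F → proj₂ ∁B≐ (i , y∈F) y∈B
        ... | no _        = tt

        S-to : ∀ {y} i → y ∈ S (c.to i) → y ∉ F i
        S-to i y∈S with em {P = ∃ λ i′ → c.to i′ ≡ c.to i}
        ... | no ¬∃ = contradiction (i , refl) ¬∃
        ... | yes (i′ , eq) with refl ← c.injective eq = y∈S

        ⊆B : ∀ {y} → (∀ n → y ∈ S n) → y ∈ B
        ⊆B y∈S = by-contradiction λ y∉B → let i , y∈F = proj₁ ∁B≐ y∉B in S-to i (y∈S (c.to i)) y∈F

  -- Infinite sequences chosen greedily

  history : (ℕ → A) → ℕ → List A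
  history s zero    = []
  history s (suc k) = s k ∷ history s k

  history-< : ∀ {P : Pred A ℓ} {s : ℕ → A} {j k} → j ℕ.< k → All P (history s k) → P (s j)
  history-< {k = suc k} j<1+k (p ∷ ps) with ℕ.m≤n⇒m<n∨m≡n (ℕ.s≤s⁻¹ j<1+k)
  ... | inj₁ j<k  = history-< j<k ps
  ... | inj₂ refl = p

  -- `Q` relates each term to the earlier ones, listed latest first; `Inv` carries whatever else is
  -- needed to keep extending.
  greedy : (Inv : List A → Set) (Q : ℕ → A → List A → Set) → Inv [] →
    (∀ k xs → Inv xs → ∃ λ x → Q k x xs × Inv (x ∷ xs)) →
    ∃ λ s → ∀ k → Q k (s k) (history s k)
  greedy {A} Inv Q inv₀ extend = s , s-Q
    where
    state : ℕ → ∃ Inv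
    state zero    = [] , inv₀
    state (suc k) =
      let xs , inv = state k
          x , _ , inv′ = extend k xs inv
      in x ∷ xs , inv′

    s : ℕ → A
    s k = let xs , inv = state k in proj₁ (extend k xs inv)

    state-history : ∀ k → proj₁ (state k) ≡ history s k
    state-history zero    = refl
    state-history (suc k) = cong (s k ∷_) (state-history k)

    s-Q : ∀ k → Q k (s k) (history s k)
    s-Q k = let xs , inv = state k
            in subst (Q k (s k)) (state-history k) (proj₁ (proj₂ (extend k xs inv)))

  -- Bases of countable spaces

  module Base {X C : Set} (u : C → Pred X 0ℓ) where

    Nonempty : Pred C 0ℓ
    Nonempty c = ∃ λ x → x ∈ u c

    Minimal : Pred C 0ℓ
    Minimal c = Nonempty c ×
      (∀ d → Nonempty d → (∀ x → x ∈ u d → x ∈ u c) → ∀ x → x ∈ u c → x ∈ u d)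

    Perfect : Pred C 0ℓ
    Perfect c = Nonempty c × (∀ d → Minimal d → ¬ (∀ x → x ∈ u d → x ∈ u c))

    Meets : C → C → Set
    Meets c d = ∃ λ x → x ∈ u c × x ∈ u d

    Irreducible : Pred C 0ℓ
    Irreducible c = Nonempty c × (∀ d e → Nonempty d → Nonempty e →
      (∀ x → x ∈ u d → x ∈ u c) → (∀ x → x ∈ u e → x ∈ u c) → Meets d e)

    DenseInPerfect : List C → Set
    DenseInPerfect L = ∀ c → Perfect c → ∃ λ d → d ∈ₗ L × Meets c d

    FinitelyIrreducible : Set
    FinitelyIrreducible = ∃ λ L → (∀ d → d ∈ₗ L → Irreducible d) × DenseInPerfect L

    -- When `u` is a basis, this says that the singleton of `x` is nowhere dense.
    Good : Pred X 0ℓ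
    Good x = ∀ c → Nonempty c → ∃ λ d → Nonempty d × (∀ y → y ∈ u d → y ∈ u c) × x ∉ u d

    PerfectAntichain : (ℕ → C) → Set
    PerfectAntichain s = (∀ n → Perfect (s n)) × (∀ m n → Meets (s m) (s n) → m ≡ n)

    module Intersections (_⊓_ : C → C → C) (u-⊓ : ∀ c d → u (c ⊓ d) ≐ u c ∩ u d) where

      ⊓-intro : ∀ {c d x} → x ∈ u c → x ∈ u d → x ∈ u (c ⊓ d)
      ⊓-intro x∈c x∈d = proj₂ (u-⊓ _ _) (x∈c , x∈d)

      ⊓-left : ∀ {c d} x → x ∈ u (c ⊓ d) → x ∈ u c
      ⊓-left _ x∈ = proj₁ (proj₁ (u-⊓ _ _) x∈)

      ⊓-right : ∀ {c d} x → x ∈ u (c ⊓ d) → x ∈ u d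
      ⊓-right _ x∈ = proj₂ (proj₁ (u-⊓ _ _) x∈)

      perfect-⊆ : ∀ {c d} → Perfect c → Nonempty d → (∀ x → x ∈ u d → x ∈ u c) → Perfect d
      perfect-⊆ (_ , noMin) ne d⊆c = ne , λ e min e⊆d → noMin e min λ x x∈e → d⊆c x (e⊆d x x∈e)

      -- If {p} is dense in c₀, then any point outside some nonempty open subset
      -- of c₀ is good, since that subset contains p.
      good-exists : ∀ {c} → Perfect c → ∃ λ x → x ∈ u c × Good x
      good-exists {c} ((p , p∈c) , noMin) with em {P = Good p}
      ... | yes good = p , p∈c , good
      ... | no ¬good =
        let c₀ , ¬g = ¬∀⇒∃¬ ¬good
            ne₀@(_ , _) , ¬avoid = ¬[→]⇒×¬ ¬g
            p∈sub : ∀ d → Nonempty d → (∀ y → y ∈ u d → y ∈ u c₀) → p ∈ u d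
            p∈sub d ne d⊆c₀ = by-contradiction λ p∉d → ¬avoid (d , ne , d⊆c₀ , p∉d)
            p∈c₀ = p∈sub c₀ ne₀ λ _ → id
            -- A subset of the perfect set `c` is not minimal, so `c₁` has a proper nonempty subset
            -- `d`; the point `x` is taken from the difference.
            c₁ = c₀ ⊓ c
            ¬min₁ = λ min → noMin c₁ min ⊓-right
            d , ¬d = ¬∀⇒∃¬ λ h → ¬min₁ ((p , ⊓-intro p∈c₀ p∈c) , h)
            ne-d , ¬d′ = ¬[→]⇒×¬ ¬d
            d⊆c₁ , ¬c₁⊆d = ¬[→]⇒×¬ ¬d′
            x , ¬x = ¬∀⇒∃¬ ¬c₁⊆d
            x∈c₁ , x∉d = ¬[→]⇒×¬ ¬x
            p∈d = p∈sub d ne-d λ y y∈d → ⊓-left y (d⊆c₁ y y∈d)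
        in x , ⊓-right x x∈c₁ , λ c₂ ne₂ → case em {P = x ∈ u c₂} of λ where
             (no x∉c₂)  → c₂ , ne₂ , (λ _ → id) , x∉c₂
             (yes x∈c₂) →
               let p∈c₂⊓c₀ = p∈sub (c₂ ⊓ c₀) (x , ⊓-intro x∈c₂ (⊓-left x x∈c₁)) ⊓-right
               in c₂ ⊓ d , (p , ⊓-intro (⊓-left p p∈c₂⊓c₀) p∈d) , ⊓-left , λ x∈ → x∉d (⊓-right x x∈)

      -- A finite union of nowhere dense sets is nowhere dense.
      good-avoid : ∀ {xs} → All Good xs → ∀ c → Nonempty c →
        ∃ λ d → Nonempty d × (∀ y → y ∈ u d → y ∈ u c) × All (_∉ u d) xs
      good-avoid []       c ne = c , ne , (λ _ → id) , []
      good-avoid (g ∷ gs) c ne =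
        let d , ne-d , d⊆c , x∉d = g c ne
            e , ne-e , e⊆d , xs∉e = good-avoid gs d ne-d
        in e , ne-e , (λ y y∈e → d⊆c y (e⊆d y y∈e)) , (λ x∈e → x∉d (e⊆d _ x∈e)) ∷ xs∉e

      -- The earlier points, being good, are avoided by a nonempty subset of `W k`; this subset is
      -- again perfect and contains a good point.
      good-sequence : (W : ℕ → C) → (∀ k → Perfect (W k)) →
        ∃ λ (p : ℕ → X) → (∀ k → p k ∈ u (W k) × Good (p k)) × (∀ j k → p j ≡ p k → j ≡ k)
      good-sequence W perfect = p , (λ k → let p∈ , good , _ = p-spec k in p∈ , good) , injective
        where
        Q : ℕ → X → List X → Set
        Q k x xs = x ∈ u (W k) × Good x × All (_≢ x) xs

        chosen : ∃ λ p → ∀ k → Q k (p k) (history p k)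
        chosen = greedy (All Good) Q [] λ k xs goods →
          let d , ne , d⊆W , xs∉d = good-avoid goods (W k) (proj₁ (perfect k))
              x , x∈d , good = good-exists (perfect-⊆ (perfect k) ne d⊆W)
          in x , (d⊆W x x∈d , good ,
                All.map (λ y∉d y≡x → y∉d (subst (_∈ u d) (sym y≡x) x∈d)) xs∉d) ,
             good ∷ goods
        p = proj₁ chosen
        p-spec = proj₂ chosen

        injective : ∀ j k → p j ≡ p k → j ≡ k
        injective j k eq with ℕ.<-cmp j k
        ... | tri< j<k _ _ = contradiction eq (history-< j<k (proj₂ (proj₂ (p-spec k))))
        ... | tri≈ _ j≡k _ = j≡k
        ... | tri> _ _ k<j = contradiction (sym eq) (history-< k<j (proj₂ (proj₂ (p-spec j))))

      good-family : {I : Set} → I ↣ ℕ → I → (W : I → C) → (∀ i → Perfect (W i)) →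
        ∃ λ (p : I → X) → (∀ i → p i ∈ u (W i) × Good (p i)) × (∀ {i j} → p i ≡ p j → i ≡ j)
      good-family c i₀ W perfect =
        let e , e-to = enumeration c i₀
            p , p-spec , p-injective = good-sequence (W ∘ e) (perfect ∘ e)
        in p ∘ to c ,
           (λ i → let p∈ , good = p-spec (to c i)
                  in subst (λ j → p (to c i) ∈ u (W j)) (e-to i) p∈ , good) ,
           λ eq → injective c (p-injective _ _ eq)
        where open Injection

      antichain : (Inv : List C → Set) → Inv [] →
        (∀ cs → Inv cs → ∃ λ c → (Perfect c × All (λ d → ¬ Meets d c) cs) × Inv (c ∷ cs)) →
        ∃ PerfectAntichain
      antichain Inv inv₀ extend =
        let s , spec = greedy Inv (λ _ c cs → Perfect c × All (λ d → ¬ Meets d c) cs)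
                              inv₀ (λ _ → extend)
        in s , (λ n → proj₁ (spec n)) , λ m n meet@(x , x∈m , x∈n) → case ℕ.<-cmp m n of λ where
             (tri< m<n _ _) → contradiction meet (history-< m<n (proj₂ (spec n)))
             (tri≈ _ m≡n _) → m≡n
             (tri> _ _ n<m) → contradiction (x , x∈n , x∈m) (history-< n<m (proj₂ (spec m)))

      -- If some perfect set contains no irreducible set, it can be split forever. Otherwise every
      -- perfect set contains an irreducible one: finitely many irreducible sets always miss some
      -- perfect set, and an irreducible subset of that set is added.
      perfectAntichain : ¬ FinitelyIrreducible → ∃ PerfectAntichain
      perfectAntichain ¬fin
        with em {P = ∃ λ v → Perfect v × (∀ d → Irreducible d → ¬ (∀ x → x ∈ u d → x ∈ u v))}
      ... | yes (v₀ , perfect₀ , noIrr) =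
        antichain Inv (v₀ , proj₁ perfect₀ , (λ _ → id) , []) split
        where
        Inv : List C → Set
        Inv cs = ∃ λ v → Nonempty v × (∀ x → x ∈ u v → x ∈ u v₀) × All (λ c → ¬ Meets c v) cs

        split : ∀ cs → Inv cs → ∃ λ c → (Perfect c × All (λ d → ¬ Meets d c) cs) × Inv (c ∷ cs)
        split cs (v , ne , v⊆ , disj) =
          -- The remainder `v` is not irreducible, so it contains disjoint nonempty sets `d` and
          -- `e`; `d` joins the antichain and `e` is the next remainder.
          let d , ¬d = ¬∀⇒∃¬ λ h → noIrr v (ne , h) v⊆
              e , ¬e = ¬∀⇒∃¬ ¬d
              ne-d , ¬e′ = ¬[→]⇒×¬ ¬e
              ne-e , ¬e″ = ¬[→]⇒×¬ ¬e′
              d⊆v , ¬e‴ = ¬[→]⇒×¬ ¬e″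
              e⊆v , ¬meet = ¬[→]⇒×¬ ¬e‴
              disj-sub : ∀ {w} → (∀ x → x ∈ u w → x ∈ u v) → All (λ c → ¬ Meets c w) cs
              disj-sub w⊆v = All.map (λ ¬m (x , x∈c , x∈w) → ¬m (x , x∈c , w⊆v x x∈w)) disj
          in d , (perfect-⊆ perfect₀ ne-d (λ x x∈d → v⊆ x (d⊆v x x∈d)) , disj-sub d⊆v) ,
             (e , ne-e , (λ x x∈e → v⊆ x (e⊆v x x∈e)) , ¬meet ∷ disj-sub e⊆v)
      ... | no everyIrr = antichain (All Irreducible) [] add
        where
        add : ∀ cs → All Irreducible cs →
          ∃ λ c → (Perfect c × All (λ d → ¬ Meets d c) cs) × All Irreducible (c ∷ cs)
        add cs irr =
          let c , ¬c = ¬∀⇒∃¬ λ dense → ¬fin (cs , (λ d d∈cs → All.lookup irr d∈cs) , dense)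
              perfect , ¬meets = ¬[→]⇒×¬ ¬c
              d , ¬d = ¬∀⇒∃¬ λ h → everyIrr (c , perfect , h)
              irr-d , ¬¬d⊆c = ¬[→]⇒×¬ ¬d
              d⊆c = by-contradiction ¬¬d⊆c
          in d , (perfect-⊆ perfect (proj₁ irr-d) d⊆c ,
                  All.tabulate (λ e∈cs (x , x∈e , x∈d) → ¬meets (_ , e∈cs , x , d⊆c x x∈d , x∈e))) ,
             irr-d ∷ irr

  -- A violation `A x ≢ A y` depends on two coordinates only. The proposition `P` absorbs side
  -- conditions that do not involve `A`.
  agree-closed : ∀ {X : Set} (P : Set) (K : X → X → Set) →
    Open (product X) (∁ λ A → P × (∀ x y → K x y → A x ≡ A y))
  agree-closed {X} P K = open-local (product X) nbhd
    where
    Agreeing : Pred (𝒫 X) 0ℓ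
    Agreeing A = P × (∀ x y → K x y → A x ≡ A y)

    SameAt : 𝒫 X → X → X → Pred (𝒫 X) 0ℓ
    SameAt A x y B = B x ≡ A x × B y ≡ A y

    sameAt-open : ∀ A x y → Open (product X) (SameAt A x y)
    sameAt-open A x y (Bx , By) =
      (x , A x) ∷ (y , A y) ∷ [] , Bx ∷ By ∷ [] , λ { (Cx ∷ Cy ∷ []) → Cx , Cy }

    nbhd : ∀ {A} → A ∉ Agreeing → ∃ λ V → Open (product X) V × A ∈ V × V ⊆ ∁ Agreeing
    nbhd {A} A∉ with em {P = P}
    ... | no ¬P = U , (λ {_} → Topology.open-U (product X)) , tt , λ _ (p , _) → ¬P p
    ... | yes p =
      let x , ¬x = ¬∀⇒∃¬ λ h → A∉ (p , h)
          y , ¬y = ¬∀⇒∃¬ ¬x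
          k , Ax≢Ay = ¬[→]⇒×¬ ¬y
      in SameAt A x y , (λ {_} → sameAt-open A x y) , (refl , refl) ,
         λ (Bx , By) (_ , h) → Ax≢Ay (trans (sym Bx) (trans (h x y k) By))

  -- Monitorable sets in a space with a countable basis

  module BasedSpace {X C : Set} (𝒯 : Topology X) (u : C → Pred X 0ℓ) (_⊓_ : C → C → C)
    (u-⊓ : ∀ c d → u (c ⊓ d) ≐ u c ∩ u d) (u-open : ∀ c → Open 𝒯 (u c))
    (basis : ∀ {V x} → Open 𝒯 V → x ∈ V → ∃ λ c → x ∈ u c × u c ⊆ V)
    (C-countable : C ↣ ℕ) (c₀ : C) where

    open Base u
    open Intersections _⊓_ u-⊓

    Constant : 𝒫 X → C → Set
    Constant A c = ∀ x y → x ∈ u c → y ∈ u c → A x ≡ A y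

    SomewhereConstant : 𝒫 X → C → Set
    SomewhereConstant A c = ∃ λ d → (Nonempty d × (∀ x → x ∈ u d → x ∈ u c)) × Constant A d

    -- Monitorability in terms of the basis alone; it lives in the lowest universe and serves as the
    -- small set that `_∈[_]_` asks for.
    monitored : Pred (𝒫 X) 0ℓ
    monitored A = ∀ c → Nonempty c → SomewhereConstant A c

    -- If a set is not dense in `u c`, some open set meeting `u c` misses it, and membership is
    -- constant on a basic set in the intersection.
    monitorable⇒monitored : ∀ {A} → Monitorable 𝒯 ⟦ A ⟧ → monitored A
    monitorable⇒monitored {A} mon c ne = case mon (u c) (u-open c) ne of λ where
        (inj₁ ¬dense)   → off ⟦ A ⟧ ¬dense λ ¬x ¬y → trans (¬T⇒false ¬x) (sym (¬T⇒false ¬y))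
        (inj₂ ¬codense) → off (∁ ⟦ A ⟧) ¬codense λ ¬¬x ¬¬y →
          trans (T⇒true (by-contradiction ¬¬x)) (sym (T⇒true (by-contradiction ¬¬y)))
      where
      T⇒true : ∀ {b} → T b → b ≡ true
      T⇒true {true} _ = refl

      ¬T⇒false : ∀ {b} → ¬ T b → b ≡ false
      ¬T⇒false {true}  ¬t = contradiction tt ¬t
      ¬T⇒false {false} _  = refl

      off : ∀ P → ¬ (u c ⊆ closure 𝒯 P) → (∀ {x y} → x ∉ P → y ∉ P → A x ≡ A y) →
        SomewhereConstant A c
      off P ¬dense same =
        let x , ¬x = ¬∀⇒∃¬ λ h → ¬dense λ {x} → h x
            x∈c , ¬cl = ¬[→]⇒×¬ ¬x
            V , ¬V = ¬∀⇒∃¬ ¬cl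
            oV , ¬V′ = ¬[→]⇒×¬ ¬V
            x∈V , V-misses = ¬[→]⇒×¬ ¬V′
            d , x∈d , d⊆ = basis (Topology.open-∩ 𝒯 (u-open c) oV) (x∈c , x∈V)
            d-misses = λ {y} (y∈d : y ∈ u d) y∈P → V-misses (y , proj₂ (d⊆ y∈d) , y∈P)
        in d , ((x , x∈d) , λ y y∈d → proj₁ (d⊆ y∈d)) ,
           λ y z y∈d z∈d → same (d-misses y∈d) (d-misses z∈d)

    -- The value of `A` at one point of the set of constancy tells which of density and codensity
    -- fails.
    monitored⇒monitorable : ∀ {A} → monitored A → Monitorable 𝒯 ⟦ A ⟧
    monitored⇒monitorable {A} mon V oV (x , x∈V)
      with c , x∈c , c⊆V ← basis oV x∈V
      with d , ((y , y∈d) , d⊆c) , const ← mon c (x , x∈c)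
      with A y in Ay
    ... | true  = inj₂ λ codense →
      let z , z∈d , z∉A = codense (c⊆V (d⊆c y y∈d)) (u d) (u-open d) y∈d
      in z∉A (subst T (trans (sym Ay) (const y z y∈d z∈d)) tt)
    ... | false = inj₁ λ dense →
      let z , z∈d , z∈A = dense (c⊆V (d⊆c y y∈d)) (u d) (u-open d) y∈d
      in subst T (trans (const z y z∈d y∈d) Ay) z∈A

    ℳ≐monitored : ℳ 𝒯 ≐ monitored
    ℳ≐monitored = monitorable⇒monitored , monitored⇒monitorable

    -- Constancy on a fixed `d` is closed, its existence below `c` is Σ⁰₂, and `monitored` is the
    -- intersection of these conditions over `c`.
    monitored-Π⁰₃ : Π⁰ (product X) 3 monitored
    monitored-Π⁰₃ = union (s≤s (s≤s z≤n)) C-countable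
      (λ c → 2 , s≤s z≤n , s≤s (s≤s (s≤s z≤n)) ,
         union ℕ.≤-refl C-countable
           (λ d → 1 , s≤s z≤n , s≤s (s≤s z≤n) , open-set (agree-closed _ _))
           (by-cases c))
      ((λ A∉ → let c , ¬c = ¬∀⇒∃¬ A∉ in c , ¬[→]⇒×¬ ¬c) ,
       (λ (c , ne , ¬some) mon → ¬some (mon c ne)))
      where
      Failing : C → Pred (𝒫 X) 0ℓ
      Failing c A = Nonempty c × ¬ SomewhereConstant A c

      -- The constancy of A on d, in the form of agree-closed; when u c is
      -- empty, Failing c is empty too and any d will do.
      Witness : C → C → Pred (𝒫 X) 0ℓ
      Witness c d A = (Nonempty c → Nonempty d × (∀ x → x ∈ u d → x ∈ u c)) ×
        (∀ x y → Nonempty c × x ∈ u d × y ∈ u d → A x ≡ A y)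

      by-cases : ∀ c → ∁ (Failing c) ≐ ⋃ C (Witness c)
      by-cases c =
        (λ {A} ¬fail → case em {P = Nonempty c} of λ where
          (no ¬ne)  → c , (λ ne → contradiction ne ¬ne) , λ x y (ne , _) → contradiction ne ¬ne
          (yes ne)  →
            let d , sub , const = by-contradiction λ ¬some → ¬fail (ne , ¬some)
            in d , (λ _ → sub) , λ x y (_ , x∈ , y∈) → const x y x∈ y∈) ,
        (λ (d , sub , const) (ne , ¬some) →
          ¬some (d , sub ne , λ x y x∈ y∈ → const x y (ne , x∈ , y∈)))

    -- The finitely irreducible case

    module _ (fin : FinitelyIrreducible) where

      private
        Forced : List C → X → X → Set
        Forced L x y = ∃ λ c → (c ∈ₗ L ⊎ Minimal c) × x ∈ u c × y ∈ u c

        Piece : List C → Pred (𝒫 X) 0ℓ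
        Piece L A = DenseInPerfect L × (∀ x y → Forced L x y → A x ≡ A y)

        -- Each irreducible set is shrunk to a core on which `A` is constant. By irreducibility the
        -- core still meets every basic set that meets the original.
        monitored⇒piece : ∀ {A} → monitored A → ∃ λ L → Piece L A
        monitored⇒piece {A} mon = cores , dense , constant
          where
          L₀ = proj₁ fin

          irreducible = proj₁ (proj₂ fin)

          shrink : ∀ {c} → c ∈ₗ L₀ → SomewhereConstant A c
          shrink c∈ = mon _ (proj₁ (irreducible _ c∈))

          cores : List C
          cores = All.reduce proj₁ (All.tabulate shrink)

          cores-constant : ∀ {L} (ps : All (SomewhereConstant A) L) →
            ∀ {c} → c ∈ₗ All.reduce proj₁ ps → Constant A c
          cores-constant ((_ , _ , const) ∷ ps) (here refl) = const
          cores-constant (_ ∷ ps)               (there c∈)  = cores-constant ps c∈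

          cores-core : ∀ {L} (ps : All (SomewhereConstant A) L) → ∀ {c} → c ∈ₗ L →
            ∃ λ d → d ∈ₗ All.reduce proj₁ ps × Nonempty d × (∀ x → x ∈ u d → x ∈ u c)
          cores-core ((d , (ne , d⊆c) , _) ∷ ps) (here refl) = d , here refl , ne , d⊆c
          cores-core (_ ∷ ps)                    (there c∈)  =
            let d , d∈ , ne , d⊆c = cores-core ps c∈ in d , there d∈ , ne , d⊆c

          dense : DenseInPerfect cores
          dense w perfect =
            let c , c∈L₀ , x , x∈w , x∈c = proj₂ (proj₂ fin) w perfect
                d , d∈ , ne , d⊆c = cores-core (All.tabulate shrink) c∈L₀
                -- Both `w ⊓ c` and the core `d` are nonempty subsets of the irreducible `c`.
                y , y∈w⊓c , y∈d = proj₂ (irreducible c c∈L₀) (w ⊓ c) d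
                  (x , ⊓-intro x∈w x∈c) ne (⊓-right) d⊆c
            in d , d∈ , y , ⊓-left y y∈w⊓c , y∈d

          constant : ∀ x y → Forced cores x y → A x ≡ A y
          constant x y (c , inj₁ c∈ , x∈ , y∈) = cores-constant (All.tabulate shrink) c∈ x y x∈ y∈
          constant x y (c , inj₂ (ne , min) , x∈ , y∈) =
            let d , (ne-d , d⊆c) , const = mon c ne
            -- By minimality the set of constancy `d` is all of `c`.
            in const x y (min d ne-d d⊆c x x∈) (min d ne-d d⊆c y y∈)

        -- A nonempty `c` either contains a minimal set or is itself perfect and meets a member of
        -- `L`; `A` is constant there in both cases.
        piece⇒monitored : ∀ {A} → (∃ λ L → Piece L A) → monitored A
        piece⇒monitored {A} (L , dense , forced) c ne
          with em {P = ∃ λ d → Minimal d × (∀ x → x ∈ u d → x ∈ u c)}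
        ... | yes (d , min , d⊆c) =
          d , (proj₁ min , d⊆c) , λ x y x∈ y∈ → forced x y (d , inj₂ min , x∈ , y∈)
        ... | no noMin =
          let d , d∈L , x , x∈c , x∈d = dense c (ne , λ d min d⊆c → noMin (d , min , d⊆c))
          in c ⊓ d , ((x , ⊓-intro x∈c x∈d) , ⊓-left) ,
             λ y z y∈ z∈ → forced y z (d , inj₁ d∈L , ⊓-right y y∈ , ⊓-right z z∈)

      monitored-Σ⁰₂ : Σ⁰ (product X) 2 monitored
      monitored-Σ⁰₂ = union ℕ.≤-refl (List-countable C-countable)
        (λ L → 1 , s≤s z≤n , s≤s (s≤s z≤n) , open-set (agree-closed _ _))
        (monitored⇒piece , piece⇒monitored)

    -- b distinguishes the points that may belong to a reduction from those
    -- that never do; length κ selects a basic open set, so that points of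
    -- either kind are dense in s n.
    Index : Set
    Index = ℕ × List ℕ × Bool

    record GoodPoints (s base : ℕ → C) : Set where
      field
        point           : Index → X
        point∈s         : ∀ n κ b → point (n , κ , b) ∈ u (s n)
        point∈base      : ∀ n κ b → Meets (s n) (base (length κ)) →
                          point (n , κ , b) ∈ u (base (length κ))
        point-good      : ∀ i → Good (point i)
        point-injective : ∀ {i j} → point i ≡ point j → i ≡ j

    goodPoints : ∀ {s} base → (∀ n → Perfect (s n)) → GoodPoints s base
    goodPoints {s} base s-perfect =
      let point , spec , injective =
            good-family Index-countable (0 , [] , true) region region-perfect
      in record
        { point           = point
        ; point∈s         = λ n κ b → region-⊆ n κ b (proj₁ (spec (n , κ , b)))
        ; point∈base      = λ n κ b meets → region-base n κ b meets (proj₁ (spec (n , κ , b)))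
        ; point-good      = λ i → proj₂ (spec i)
        ; point-injective = injective
        }
      where
      Index-countable : Index ↣ ℕ
      Index-countable =
        ×-countable ℕ-countable (×-countable (List-countable ℕ-countable) Bool-countable)

      -- The fallback to `s n` keeps every region a perfect subset of `s n`, even when the selected
      -- basic set lies elsewhere.
      region : Index → C
      region (n , κ , _) with em {P = Meets (s n) (base (length κ))}
      ... | yes _ = s n ⊓ base (length κ)
      ... | no _  = s n

      region-perfect : ∀ i → Perfect (region i)
      region-perfect (n , κ , _) with em {P = Meets (s n) (base (length κ))}
      ... | yes (x , x∈s , x∈b) =
        perfect-⊆ (s-perfect n) (x , ⊓-intro x∈s x∈b) (⊓-left)
      ... | no _ = s-perfect n

      region-⊆ : ∀ n κ b {x} → x ∈ u (region (n , κ , b)) → x ∈ u (s n)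
      region-⊆ n κ _ x∈ with em {P = Meets (s n) (base (length κ))}
      ... | yes _ = ⊓-left _ x∈
      ... | no _  = x∈

      region-base : ∀ n κ b {x} → Meets (s n) (base (length κ)) → x ∈ u (region (n , κ , b)) →
        x ∈ u (base (length κ))
      region-base n κ _ meets x∈ with em {P = Meets (s n) (base (length κ))}
      ... | yes _     = ⊓-right _ x∈
      ... | no ¬meets = contradiction meets ¬meets

    -- The reduction of Π⁰₃ sets to monitorability

    module Reduction {Y : Set} {𝒮 : Topology Y} {S : ℕ → Pred Y 0ℓ}
      (coding : ∀ n → Coding {𝒮 = 𝒮} (S n))
      {s base : ℕ → C} (s-antichain : PerfectAntichain s) (base-onto : ∀ c → ∃ λ k → base k ≡ c)
      (points : GoodPoints s base) where

      open GoodPoints points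

      private
        module Code n = Coding (coding n)

        s-perfect : ∀ n → Perfect (s n)
        s-perfect = proj₁ s-antichain

        s-disjoint : ∀ m n → Meets (s m) (s n) → m ≡ n
        s-disjoint = proj₂ s-antichain

        Marked : X → Set
        Marked x = ∃ λ n → ∃ λ κ → x ≡ point (n , κ , true)

      -- The value at a point is either one code bit or always `false`, whence continuity. Points
      -- with flag `false` are never marked, by injectivity.
      reduction : Y → 𝒫 X
      reduction y x with em {P = Marked x}
      ... | yes (n , κ , _) = Code.code n κ y
      ... | no _            = false

      reduction-continuous : Continuous 𝒮 (product X) reduction
      reduction-continuous = product-continuous {𝒮 = 𝒮} {f = reduction} lc
        where
        lc : ∀ x → LocallyConstant 𝒮 (λ y → reduction y x)
        lc x with em {P = Marked x}
        ... | yes (n , κ , _) = Code.code-lc n κ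
        ... | no _            = const-lc 𝒮 false

      private
        reduction-true : ∀ n κ y → reduction y (point (n , κ , true)) ≡ Code.code n κ y
        reduction-true n κ y with em {P = Marked (point (n , κ , true))}
        ... | no ¬marked = contradiction (n , κ , refl) ¬marked
        ... | yes (_ , _ , eq) with refl ← point-injective eq = refl

        reduction-false : ∀ n κ y → reduction y (point (n , κ , false)) ≡ false
        reduction-false n κ y with em {P = Marked (point (n , κ , false))}
        ... | no _ = refl
        ... | yes (_ , _ , eq) with () ← point-injective eq

        reduction-marked : ∀ {y x} → reduction y x ≡ true →
          ∃ λ n → ∃ λ κ → x ≡ point (n , κ , true) × Code.code n κ y ≡ true
        reduction-marked {y} {x} eq with em {P = Marked x}
        ... | yes (n , κ , x≡) = n , κ , x≡ , eq

        monitored⇒S : ∀ {y} → monitored (reduction y) → ∀ n → y ∈ S n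
        monitored⇒S {y} mon n = by-contradiction λ y∉S →
          let d , ((x , x∈d) , d⊆s) , const = mon (s n) (proj₁ (s-perfect n))
              -- The length of `κ` is chosen so that `base (length κ)` is `d`; the two points for
              -- `κ` then lie in `d` with different values.
              κ , len , hit = Code.infinite n y∉S (proj₁ (base-onto d))
              base≡d = trans (cong base len) (proj₂ (base-onto d))
              meets = x , d⊆s x x∈d , subst (λ c → x ∈ u c) (sym base≡d) x∈d
              in-d = λ b → subst (λ c → point (n , κ , b) ∈ u c) base≡d
                                 (point∈base n κ b meets)
          in contradiction
               (trans (sym (trans (reduction-true n κ y) hit))
                 (trans (const _ _ (in-d true) (in-d false)) (reduction-false n κ y)))
               λ ()

        -- Within `s n` only the finitely many points with active codes belong to the reduced set,
        -- and being good they can be avoided. A set meeting no `s n` contains no marked point.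
        S⇒monitored : ∀ {y} → (∀ n → y ∈ S n) → monitored (reduction y)
        S⇒monitored {y} y∈S c ne with em {P = ∃ λ n → Meets c (s n)}
        ... | no ¬meets = c , (ne , λ _ → id) , λ x z x∈ z∈ → trans (off x x∈) (sym (off z z∈))
          where
          off : ∀ x → x ∈ u c → reduction y x ≡ false
          off x x∈c = Bool.¬-not λ on →
            let n , κ , x≡ , _ = reduction-marked on
            in ¬meets (n , x , x∈c , subst (_∈ u (s n)) (sym x≡) (point∈s n κ true))
        ... | yes (n , x₀ , x₀∈c , x₀∈s) =
          let d , ne-d , d⊆ , avoid = good-avoid goods (c ⊓ s n) (x₀ , ⊓-intro x₀∈c x₀∈s)
              off = λ x (x∈d : x ∈ u d) → Bool.¬-not λ on →
                let n′ , κ , x≡ , hit = reduction-marked on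
                    x∈s′ = subst (_∈ u (s n′)) (sym x≡) (point∈s n′ κ true)
                    -- As `d` lies in `s n`, a marked point of `d` can only belong to `n` itself.
                    n′≡n = s-disjoint n′ n (x , x∈s′ , ⊓-right x (d⊆ x x∈d))
                in avoided n′≡n hit avoid (subst (_∈ u d) x≡ x∈d)
          in d , (ne-d , λ x x∈d → ⊓-left x (d⊆ x x∈d)) ,
             λ x z x∈ z∈ → trans (off x x∈) (sym (off z z∈))
          where
          L : List (List ℕ)
          L = proj₁ (Code.finite n (y∈S n))

          marks : List X
          marks = map (λ κ → point (n , κ , true)) L

          goods : All Good marks
          goods = All.tabulate λ x∈ →
            let κ , _ , x≡ = ∈-map⁻ _ x∈ in subst Good (sym x≡) (point-good _)

          avoided : ∀ {n′ κ d} → n′ ≡ n → Code.code n′ κ y ≡ true → All (_∉ u d) marks →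
            point (n′ , κ , true) ∉ u d
          avoided refl hit avoid = All.lookup avoid (∈-map⁺ _ (proj₂ (Code.finite n (y∈S n)) _ hit))

      reduction-correct : (λ y → ∀ n → y ∈ S n) ≐ reduction ⊢ monitored
      reduction-correct = S⇒monitored , monitored⇒S

    ¬fin⇒complete : ¬ FinitelyIrreducible → IsCompleteFor (λ 𝒯 → Π⁰ 𝒯 3) (product X) (ℳ 𝒯)
    ¬fin⇒complete ¬fin = (monitored , ℳ≐monitored , monitored-Π⁰₃) , λ 𝒮 polish zd B B-Π⁰₃ →
      let S , coding , (B⊆ , ⊆B) = Π⁰₃-coding (polish-countablyClopen {𝒮 = 𝒮} polish zd) B-Π⁰₃
          s , s-antichain = perfectAntichain ¬fin
          base , base-to = enumeration C-countable c₀
          open Reduction coding s-antichain (λ c → _ , base-to c) (goodPoints base (proj₁ s-antichain))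
          f⊆ , ⊆f = reduction-correct
      in reduction , reduction-continuous ,
         (λ y∈B → proj₂ ℳ≐monitored (f⊆ (B⊆ y∈B))) , (λ mon → ⊆B (⊆f (proj₁ ℳ≐monitored mon)))

  -- Π⁰₃-complete sets are not Σ⁰₂

  -- `EventuallyFalse` is a countable union of closed sets, one for each bound `N`.
  infinitelyTrue-Π⁰₃ : Π⁰ (product ℕ) 3 (∁ EventuallyFalse)
  infinitelyTrue-Π⁰₃ = union (s≤s (s≤s z≤n)) ℕ-countable
    (λ N → 1 , s≤s z≤n , s≤s (s≤s z≤n) , open-set (cylinder⇒cantorOpen λ {x} ¬false →
       let m , ¬m = ¬∀⇒∃¬ ¬false
           N≤m , xm≢false = ¬[→]⇒×¬ ¬m
       in suc m , λ x~y y-false → xm≢false (trans (x~y m ℕ.≤-refl) (y-false m N≤m))))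
    (by-contradiction , λ ef ¬ef → ¬ef ef)

  -- A reduction to a Σ⁰₂ set would make `∁ EventuallyFalse` a countable union of closed sets, so
  -- `EventuallyFalse` would be a Gδ set, against the Baire argument.
  complete⇒¬Σ⁰₂ : {P : Pred (𝒫 X) ℓ} → IsCompleteFor (λ 𝒯 → Π⁰ 𝒯 3) (product X) P →
    ¬ (P ∈[ (λ 𝒯 → Σ⁰ 𝒯 2) ] product X)
  complete⇒¬Σ⁰₂ {X = X} (_ , reduce) (S , (P⊆ , ⊆P) , union {B = F} _ c closed (S⊆ , ⊆S)) =
    let f , f-cont , ⊆f , f⊆ =
          reduce (product ℕ) cantor-polish cantor-zeroDimensional _ infinitelyTrue-Π⁰₃
        x , x∉F , x∉EF = eventuallyFalse-notGδ {O = λ i → f ⊢ ∁ (F i)} c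
          (λ i → f-cont (∁ (F i)) (∁F-open i))
          (λ i x∈EF fx∈F → f⊆ (⊆P (⊆S (i , fx∈F))) x∈EF)
        i , fx∈F = S⊆ (P⊆ (⊆f x∉EF))
    in x∉F i fx∈F
    where
    ∁F-open : ∀ i → Open (product X) (∁ (F i))
    ∁F-open i = let _ , _ , β<2 , σ = closed i in Σ⁰₁-open β<2 σ

  -- Borel sets

  module _ {𝒯 : Topology Z} where

    borel-∀ : {I : Set} {A : I → Pred Z 0ℓ} → I ↣ ℕ → (∀ i → Borel 𝒯 (A i)) →
      Borel 𝒯 (λ z → ∀ i → A i z)
    borel-∀ c A-borel = resp
      ((λ ¬∃ i → by-contradiction λ ¬a → ¬∃ (i , ¬a)) , λ all (i , ¬a) → ¬a (all i))
      (complement (union c (λ i → complement (A-borel i))))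

    borel-× : {A B : Pred Z 0ℓ} → Borel 𝒯 A → Borel 𝒯 B → Borel 𝒯 (λ z → A z × B z)
    borel-× {A} {B} A-borel B-borel = resp
      ((λ h → h true , h false) , λ { (a , b) true → a ; (a , b) false → b })
      (borel-∀ {A = λ b → if b then A else B} Bool-countable λ { true → A-borel ; false → B-borel })

    borel-→ : {A B : Pred Z 0ℓ} → Borel 𝒯 A → Borel 𝒯 B → Borel 𝒯 (λ z → A z → B z)
    borel-→ A-borel B-borel = resp
      ((λ h a → by-contradiction λ ¬b → h (a , ¬b)) , λ f (a , ¬b) → ¬b (f a))
      (complement (borel-× A-borel (complement B-borel)))

    borel-const : (P : Set) → Borel 𝒯 (λ _ → P)
    borel-const P = open-set (open-local 𝒯 λ p → U , Topology.open-U 𝒯 , tt , λ _ → p)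

  -- The topologies 𝒯⟨ R ⟩

  module _ {X E : Set} where

    -- The existence of the states required by `basic`, recast by recursion on the sequence so that
    -- Borel complexity follows by induction.
    Path : 𝒫 (X × E × X) → X → List E → Set
    Path R x []      = ⊤
    Path R x (e ∷ s) = ∃ λ y → (x , e , y) ∈ ⟦ R ⟧ × Path R y s

    states : ∀ {R x} s → Path R x s → Fin (suc (length s)) → X
    states {x = x} s       _           zero    = x
    states         (e ∷ s) (_ , _ , p) (suc i) = states s p i

    states-step : ∀ {R x} s (p : Path R x s) h →
      (states s p (inject₁ h) , lookup s h , states s p (suc h)) ∈ ⟦ R ⟧
    states-step (e ∷ []) (_ , r , p) zero = r
    states-step (e ∷ _ ∷ _) (_ , r , p) zero = r
    states-step (e ∷ s) (_ , r , p) (suc h) = states-step s p h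

    path⇒basic : ∀ {R F x} → All (Path R x) F → x ∈ basic R F
    path⇒basic = All.map λ {s} p → states s p , refl , states-step s p

    basic⇒path : ∀ {R F x} → x ∈ basic R F → All (Path R x) F
    basic⇒path {R} = All.map λ {s} (q , q₀≡x , steps) →
      subst (λ x → Path R x s) q₀≡x (path s q steps)
      where
      path : ∀ s (q : Fin (suc (length s)) → X) →
        (∀ h → (q (inject₁ h) , lookup s h , q (suc h)) ∈ ⟦ R ⟧) → Path R (q zero) s
      path []      q steps = tt
      path (e ∷ s) q steps = q (suc zero) , steps zero , path s (q ∘ suc) (steps ∘ suc)

    basic-++ : ∀ (R : 𝒫 (X × E × X)) F G → basic R (F ++ G) ≐ basic R F ∩ basic R G
    basic-++ R F G = (λ x∈ → ++⁻ˡ F x∈ , ++⁻ʳ F x∈) , λ (x∈F , x∈G) → ++⁺ x∈F x∈G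

    basic-open : ∀ (R : 𝒫 (X × E × X)) F → Open 𝒯⟨ R ⟩ (basic R F)
    basic-open R F x∈ = F ∷ [] , x∈ ∷ [] , All.head

    basic-basis : ∀ (R : 𝒫 (X × E × X)) {V x} → Open 𝒯⟨ R ⟩ V → x ∈ V →
      ∃ λ F → x ∈ basic R F × basic R F ⊆ V
    basic-basis R oV x∈V =
      let Fs , x∈ , ⊆V = oV x∈V in concat Fs , concat⁺ x∈ , λ y∈ → ⊆V (concat⁻ y∈)

  -- The dividing line as a Borel condition on relations

  module _ {X E : Set} (X-countable : X ↣ ℕ) (E-countable : E ↣ ℕ) where

    private
      relations : Topology (𝒫 (X × E × X))
      relations = product (X × E × X)

      Fin-irr : Pred (𝒫 (X × E × X)) 0ℓ
      Fin-irr R = Base.FinitelyIrreducible (basic R)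

      C-countable : List (List E) ↣ ℕ
      C-countable = List-countable (List-countable E-countable)

      module Space (R : 𝒫 (X × E × X)) =
        BasedSpace 𝒯⟨ R ⟩ (basic R) _++_ (basic-++ R) (basic-open R) (basic-basis R) C-countable []

    path-borel : ∀ x s → Borel relations (λ R → Path R x s)
    path-borel x []      = borel-const ⊤
    path-borel x (e ∷ s) = union X-countable λ y →
      borel-× (resp ((λ {R} → T⇐ {R (x , e , y)}) , λ {R} → T⇒ {R (x , e , y)})
                    (open-set λ {R} Rxey → ((x , e , y) , true) ∷ [] , Rxey ∷ [] , All.head))
              (path-borel y s)
      where
      T⇐ : ∀ {b} → b ≡ true → T b
      T⇐ refl = tt

      T⇒ : ∀ {b} → T b → b ≡ true
      T⇒ {true} _ = refl

    basic-borel : ∀ F x → Borel relations (λ R → x ∈ basic R F)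
    basic-borel F x = resp (path⇒basic , basic⇒path) (all F)
      where
      all : ∀ F → Borel relations (λ R → All (Path R x) F)
      all []      = resp ((λ _ → []) , λ _ → tt) (borel-const ⊤)
      all (s ∷ F) = resp ((λ (p , ps) → p ∷ ps) , λ { (p ∷ ps) → p , ps })
                         (borel-× (path-borel x s) (all F))

    nonempty-borel : ∀ F → Borel relations (λ R → Base.Nonempty (basic R) F)
    nonempty-borel F = union X-countable (basic-borel F)

    ⊆-borel : ∀ F G → Borel relations (λ R → ∀ x → x ∈ basic R F → x ∈ basic R G)
    ⊆-borel F G = borel-∀ X-countable λ x → borel-→ (basic-borel F x) (basic-borel G x)

    minimal-borel : ∀ F → Borel relations (λ R → Base.Minimal (basic R) F)
    minimal-borel F = borel-× (nonempty-borel F) (borel-∀ C-countable λ G →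
      borel-→ (nonempty-borel G) (borel-→ (⊆-borel G F) (⊆-borel F G)))

    perfect-borel : ∀ F → Borel relations (λ R → Base.Perfect (basic R) F)
    perfect-borel F = borel-× (nonempty-borel F) (borel-∀ C-countable λ G →
      borel-→ (minimal-borel G) (complement (⊆-borel G F)))

    meets-borel : ∀ F G → Borel relations (λ R → Base.Meets (basic R) F G)
    meets-borel F G = union X-countable λ x → borel-× (basic-borel F x) (basic-borel G x)

    irreducible-borel : ∀ F → Borel relations (λ R → Base.Irreducible (basic R) F)
    irreducible-borel F = borel-× (nonempty-borel F)
      (borel-∀ C-countable λ G → borel-∀ C-countable λ H →
      borel-→ (nonempty-borel G) (borel-→ (nonempty-borel H)
        (borel-→ (⊆-borel G F) (borel-→ (⊆-borel H F) (meets-borel G H)))))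

    finitelyIrreducible-borel : Borel relations Fin-irr
    finitelyIrreducible-borel = union (List-countable C-countable) λ L → borel-×
      (borel-∀ C-countable λ F → borel-→ (borel-const (F ∈ₗ L)) (irreducible-borel F))
      (borel-∀ C-countable λ F → borel-→ (perfect-borel F)
        (union C-countable λ G → borel-× (borel-const (G ∈ₗ L)) (meets-borel F G)))

    ¬finitelyIrreducible⇒ℛ₁ : ∀ R → ¬ Fin-irr R → R ∈ ℛ₁ X E
    ¬finitelyIrreducible⇒ℛ₁ R = Space.¬fin⇒complete R

    finitelyIrreducible⇒ℛ₀ : ∀ R → Fin-irr R → R ∈ ℛ₀ X E
    finitelyIrreducible⇒ℛ₀ R fin =
      Space.monitored R , Space.ℳ≐monitored R , Space.monitored-Σ⁰₂ R fin

    ℛ₀⇒finitelyIrreducible : ∀ R → R ∈ ℛ₀ X E → Fin-irr R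
    ℛ₀⇒finitelyIrreducible R R∈ℛ₀ = by-contradiction λ ¬fin →
      complete⇒¬Σ⁰₂ (¬finitelyIrreducible⇒ℛ₁ R ¬fin) R∈ℛ₀

    ℛ₁≐∁ℛ₀ : ℛ₁ X E ≐ ∁ (ℛ₀ X E)
    ℛ₁≐∁ℛ₀ = complete⇒¬Σ⁰₂ , λ {R} R∉ℛ₀ →
      ¬finitelyIrreducible⇒ℛ₁ R λ fin → R∉ℛ₀ (finitelyIrreducible⇒ℛ₀ R fin)

    ℛ₀≐finitelyIrreducible : ℛ₀ X E ≐ Fin-irr
    ℛ₀≐finitelyIrreducible = (λ {R} → ℛ₀⇒finitelyIrreducible R) , λ {R} → finitelyIrreducible⇒ℛ₀ R

    ℛ₁≐∁finitelyIrreducible : ℛ₁ X E ≐ ∁ Fin-irr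
    ℛ₁≐∁finitelyIrreducible =
      (λ {R} R∈ℛ₁ fin → complete⇒¬Σ⁰₂ R∈ℛ₁ (finitelyIrreducible⇒ℛ₀ R fin)) ,
      λ {R} → ¬finitelyIrreducible⇒ℛ₁ R

    -- Meagreness

    Dead : X × E → Pred (𝒫 (X × E × X)) 0ℓ
    Dead (x , e) R = ∀ y → (x , e , y) ∉ ⟦ R ⟧

    -- Without dead pairs every path exists, so every basic set is all of `X` and every nonempty one
    -- is minimal. There are then no perfect sets, and the empty list witnesses `Fin-irr`.
    ¬finitelyIrreducible⇒dead : ∀ R → ¬ Fin-irr R → ∃ λ i → Dead i R
    ¬finitelyIrreducible⇒dead R ¬fin = by-contradiction λ ¬dead →
      let edge = λ x e → by-contradiction λ ¬edge → ¬dead ((x , e) , λ y r → ¬edge (y , r))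
      in ¬fin ([] , (λ _ ()) , λ F (ne , noMin) →
           contradiction (λ _ → id) (noMin F (ne , λ G _ _ x _ →
             path⇒basic (All.tabulate λ {s} _ → path edge s x))))
      where
      path : (∀ x e → ∃ λ y → (x , e , y) ∈ ⟦ R ⟧) → ∀ s x → Path R x s
      path edge []      x = tt
      path edge (e ∷ s) x = let y , r = edge x e in y , r , path edge s y

    module _ (fresh : (ys : List X) → ∃ λ y → y ∉ₗ ys) where

      -- A basic neighbourhood constrains finitely many triples. For a `y` occurring in none of them
      -- the edge `(x , e , y)` can be added, and having this edge is an open condition disjoint
      -- from `Dead (x , e)`.
      dead-nowhereDense : ∀ i → NowhereDense relations (Dead i)
      dead-nowhereDense (x , e) R (V , oV , R∈V , V⊆cl) =
        let is , R∈ , ⊆V = oV R∈V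
            y , y∉ = fresh (map (λ ((_ , _ , y) , _) → y) is)
            R′ , R′xey , R′≡R = set-true (x , e , y)
            R′∈V = ⊆V (All.tabulate λ {(t , b)} t∈ →
              trans (R′≡R t λ t≡ → y∉ (subst (_∈ₗ _) (cong (proj₂ ∘ proj₂) t≡) (∈-map⁺ _ t∈)))
                    (All.lookup R∈ t∈))
            S , Sxey , S-dead = V⊆cl R′∈V (λ S → S (x , e , y) ≡ true)
              (λ Sxey → ((x , e , y) , true) ∷ [] , Sxey ∷ [] , All.head) R′xey
        in S-dead y (subst T (sym Sxey) tt)
        where
        set-true : ∀ t → ∃ λ R′ → R′ t ≡ true × (∀ t′ → t′ ≢ t → R′ t′ ≡ R t′)
        set-true t = R′ , R′t , R′≢
          where
          R′ : 𝒫 (X × E × X)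
          R′ t′ with em {P = t′ ≡ t}
          ... | yes _ = true
          ... | no _  = R t′

          R′t : R′ t ≡ true
          R′t with em {P = t ≡ t}
          ... | yes _  = refl
          ... | no t≢t = contradiction refl t≢t

          R′≢ : ∀ t′ → t′ ≢ t → R′ t′ ≡ R t′
          R′≢ t′ t′≢t with em {P = t′ ≡ t}
          ... | yes t′≡t = contradiction t′≡t t′≢t
          ... | no _     = refl

      ∁finitelyIrreducible-meagre : {A : Pred (𝒫 (X × E × X)) ℓ} → A ≐ ∁ Fin-irr →
        Meagre relations A
      ∁finitelyIrreducible-meagre {A = A} (A⊆ , ⊆A) =
        (X × E) , N , ×-countable X-countable E-countable , N-nowhereDense ,
        (λ {R} R∈A → let i , dead = ¬finitelyIrreducible⇒dead R (A⊆ R∈A) in i , A⊆ R∈A , dead) ,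
        λ (_ , ¬fin , _) → ⊆A ¬fin
        where
        N : X × E → Pred (𝒫 (X × E × X)) 0ℓ
        -- `Meagre` asks for equality with the union, so the dead sets are cut down to the
        -- complement of `Fin-irr`.
        N i R = ¬ Fin-irr R × Dead i R

        N-nowhereDense : ∀ i → NowhereDense relations (N i)
        N-nowhereDense i R (V , oV , R∈V , V⊆cl) = dead-nowhereDense i R
          (V , oV , R∈V , λ S∈V W oW S∈W →
            let S′ , S′∈W , _ , dead = V⊆cl S∈V W oW S∈W in S′ , S′∈W , dead)

  strictBound : (ns : List ℕ) → ∃ λ b → ∀ {n} → n ∈ₗ ns → n ℕ.< b
  strictBound []       = 0 , λ ()
  strictBound (n ∷ ns) =
    let b , <b = strictBound ns
    in suc n ℕ.⊔ b , λ where
         (here refl) → ℕ.m≤m⊔n (suc n) b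
         (there n∈)  → ℕ.≤-trans (<b n∈) (ℕ.m≤n⊔m (suc n) b)

theorem3p18 : (∀ ℓ → ExcludedMiddle ℓ) →
    (X E : Set) → X ↔ ℕ → E → AtMostCountable E →
    (ℛ₁ X E ≐ ∁ (ℛ₀ X E)) ×
    ((ℛ₀ X E ∈[ Borel ] product (X × E × X)) × (ℛ₁ X E ∈[ Borel ] product (X × E × X))) ×
    (Comeagre (product (X × E × X)) (ℛ₀ X E) × Meagre (product (X × E × X)) (ℛ₁ X E))
theorem3p18 em X E X↔ℕ _ E-countable =
  ℛ₁≐∁ℛ₀ X-countable E-countable ,
  ((_ , ℛ₀≐finitelyIrreducible X-countable E-countable ,
    finitelyIrreducible-borel X-countable E-countable) ,
   (_ , ℛ₁≐∁finitelyIrreducible X-countable E-countable ,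
    complement (finitelyIrreducible-borel X-countable E-countable))) ,
  (∁finitelyIrreducible-meagre X-countable E-countable fresh
     ((λ {R} R∉ℛ₀ fin → R∉ℛ₀ (finitelyIrreducible⇒ℛ₀ X-countable E-countable R fin)) ,
      λ {R} ¬fin R∈ℛ₀ → ¬fin (ℛ₀⇒finitelyIrreducible X-countable E-countable R R∈ℛ₀)) ,
   ∁finitelyIrreducible-meagre X-countable E-countable fresh
     (ℛ₁≐∁finitelyIrreducible X-countable E-countable))
  where
  excludedMiddle : ∀ {ℓ} {P : Set ℓ} → Dec P
  excludedMiddle {ℓ} = em ℓ

  open Classical excludedMiddle
  module X↔ℕ = Inverse X↔ℕ

  X-countable : X ↣ ℕ
  X-countable = mk↣ λ eq →
    trans (sym (X↔ℕ.strictlyInverseʳ _))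
          (trans (cong X↔ℕ.from eq) (X↔ℕ.strictlyInverseʳ _))

  fresh : (ys : List X) → ∃ λ y → y ∉ₗ ys
  fresh ys =
    let b , <b = strictBound (map X↔ℕ.to ys)
    in X↔ℕ.from b , λ y∈ →
         ℕ.<-irrefl (X↔ℕ.strictlyInverseˡ b) (<b (∈-map⁺ X↔ℕ.to y∈))
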